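{- Let $T$ be a tree with at least $3$ vertices. Then \[ Z_1(T)=2+\max_{v\in V(T)}\Bigg(\max_{\substack{S\subseteq T\\ v\in V(S)}}\Bigg(\min_{P\in\mathcal{P}_S(v)}\sum_{w\in V(P)}\big(\deg_S(w)-2\big)\Bigg)\Bigg), \] where $S$ ranges over the subtrees (connected subgraphs) of $T$ containing $v$.
   Context: Filling rule: if a filled vertex has exactly one unfilled neighbor (and any number of filled neighbors), that neighbor becomes filled; "applying the filling rule in a subgraph $H$" means applying it with neighborhoods taken in $H$. The $Z_q$-Game on $G$ ($q\ge 0$ an integer): initially all vertices are unfilled; a player repeatedly performs one of the following operations until all vertices are filled: (1) for one token, change any vertex from unfilled to filled; (2) at no cost, apply the filling rule in $G$; (3) if $F$ is the current set of filled vertices and $U_1,\dots,U_k$ are the vertex sets of the connected components of $G[V(G)\setminus F]$ with $k\ge q+1$, the player announces a selection of at least $q+1$ of the $U_i$ to an oracle (an adversary), the oracle returns a nonempty subset $\{U_{i_1},\dots,U_{i_\ell}\}$ of the selected components, and the player may at no cost apply the filling rule in $G[F\cup U_{i_1}\cup\cdots\cup U_{i_\ell}]$. $Z_q(G)$ is the minimum number of tokens with which the player can guarantee that all vertices become filled, regardless of the oracle's responses. For a subtree $S$ and $w\in V(S)$, $\deg_S(w)$ is the degree of $w$ in $S$. $\mathcal{P}_S(v)$ is the set of maximal paths in $S$ having $v$ as an endpoint (paths with endpoint $v$ not contained in a longer path with endpoint $v$; if $S$ is the single vertex $v$, this is the one-vertex path). -}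

module Defs where

open import Data.Fin.Base using (Fin)
open import Data.Fin.Subset
  using (Subset; _∈_; _∉_; _⊆_; ⊥; ⁅_⁆; ∁; _∩_; _∪_; ⋃; ∣_∣; Nonempty)
open import Data.Fin.Subset.Properties using (_∈?_; x∈p∩q⁺)
open import Data.Integer.Base as ℤ using (ℤ; +_)
open import Data.List.Base using (List; []; _∷_; _∷ʳ_; length; map; foldr)
open import Data.List.Relation.Binary.Prefix.Heterogeneous using (Prefix)
import Data.List.Relation.Binary.Sublist.Propositional as Sublist
open import Data.List.Relation.Unary.All using (All)
open import Data.List.Relation.Unary.Linked using (Linked)
open import Data.List.Relation.Unary.Unique.Propositional using (Unique)
open import Data.Nat.Base as ℕ using (ℕ; suc)
open import Data.Product.Base using (∃; ∃₂; _×_; _,_)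
open import Data.Vec.Base using (tabulate)
open import Function.Base using (_∘_)
open import Level using (Level; 0ℓ; _⊔_)
open import Relation.Binary.Core using (Rel)
open import Relation.Binary.Definitions using (Decidable; Symmetric)
open import Relation.Binary.Construct.Closure.ReflexiveTransitive using (Star)
open import Relation.Binary.PropositionalEquality.Core using (_≡_; _≢_)
open import Relation.Nullary using (¬_; does; _×-dec_)
open import Relation.Unary using (Pred)

module _ {a ℓ₁ ℓ₂ : Level} {A : Set a} (_≤_ : Rel A ℓ₁) where

  IsLeast : Pred A ℓ₂ → Pred A (a ⊔ ℓ₁ ⊔ ℓ₂)
  IsLeast P m = P m × (∀ x → P x → m ≤ x)

  IsGreatest : Pred A ℓ₂ → Pred A (a ⊔ ℓ₁ ⊔ ℓ₂)
  IsGreatest P m = P m × (∀ x → P x → x ≤ m)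

-- A finite simple graph. The vertex set is a subset of an ambient Fin n, so
-- that a graph, its subgraphs and its induced subgraphs all have the same type.
record Graph (n : ℕ) : Set₁ where
  infix 4 _~_ _~?_
  field
    V        : Subset n
    _~_      : Rel (Fin n) 0ℓ
    _~?_     : Decidable _~_
    ~-sym    : Symmetric _~_
    ~-irrefl : ∀ {v} → ¬ (v ~ v)
    ~⇒∈V     : ∀ {u v} → u ~ v → u ∈ V

open Graph using (V)

private
  variable
    n : ℕ

_∋_~_ : Graph n → Rel (Fin n) 0ℓ
G ∋ u ~ v = Graph._~_ G u v

infix 4 _⊑_

_⊑_ : Graph n → Graph n → Set
H ⊑ G = V H ⊆ V G × (∀ {u v} → H ∋ u ~ v → G ∋ u ~ v)

-- The subgraph induced by V G ∩ X.
_[_] : Graph n → Subset n → Graph n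
G [ X ] = record
  { V        = V G ∩ X
  ; _~_      = λ u v → u ∈ X × v ∈ X × u ~ v
  ; _~?_     = λ u v → (u ∈? X) ×-dec (v ∈? X) ×-dec (u ~? v)
  ; ~-sym    = λ (u∈X , v∈X , u~v) → v∈X , u∈X , ~-sym u~v
  ; ~-irrefl = λ (_ , _ , v~v) → ~-irrefl v~v
  ; ~⇒∈V     = λ (u∈X , _ , u~v) → x∈p∩q⁺ (~⇒∈V u~v , u∈X)
  }
  where open Graph G hiding (V)

deg : Graph n → Fin n → ℕ
deg G w = ∣ tabulate (λ u → does (Graph._~?_ G w u)) ∣

Connected : Graph n → Set
Connected G = Nonempty (V G) × (∀ {u v} → u ∈ V G → v ∈ V G → Star (Graph._~_ G) u v)

-- The vertices of the path, or of the cycle, are listed in order.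
IsPath : Graph n → List (Fin n) → Set
IsPath G vs = vs ≢ [] × All (_∈ V G) vs × Linked (Graph._~_ G) vs × Unique vs

-- The closing edge of the cycle is the last link of (v ∷ vs) ∷ʳ v.
IsCycle : Graph n → Fin n → List (Fin n) → Set
IsCycle G v vs =
  3 ℕ.≤ length (v ∷ vs) × Linked (Graph._~_ G) ((v ∷ vs) ∷ʳ v) × Unique (v ∷ vs)

IsTree : Graph n → Set
IsTree G = Connected G × ¬ ∃₂ (IsCycle G)

IsComponent : Graph n → Subset n → Set
IsComponent G U =
  U ⊆ V G × Connected (G [ U ]) ×
  (∀ W → W ⊆ V G → Connected (G [ W ]) → U ⊆ W → W ⊆ U)

-- One application, in H, of the filling rule to the set F of filled vertices.
data _⊢_⟶_ {n} (H : Graph n) (F : Subset n) : Subset n → Set where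
  fill : ∀ u w → u ∈ F → w ∉ F → H ∋ u ~ w →
         (∀ x → H ∋ u ~ x → x ∉ F → x ≡ w) →
         H ⊢ F ⟶ (F ∪ ⁅ w ⁆)

-- Wins q G k F: in the Z_q-game on G, from the position with filled set F, the
-- player can force all vertices to become filled in finitely many moves while
-- spending at most k tokens. The player may apply the filling rule repeatedly
-- after a response Rs of the oracle, in the same subgraph G[F ∪ ⋃ Rs].
data Wins {n} (q : ℕ) (G : Graph n) : ℕ → Subset n → Set where
  done   : ∀ {k F} → V G ⊆ F → Wins q G k F
  token  : ∀ {k F} v → v ∈ V G → v ∉ F → Wins q G k (F ∪ ⁅ v ⁆) → Wins q G (suc k) F
  force  : ∀ {k F F′} → G ⊢ F ⟶ F′ → Wins q G k F′ → Wins q G k F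
  oracle : ∀ {k F} (Us : List (Subset n)) →
           All (IsComponent (G [ ∁ F ])) Us → Unique Us → suc q ℕ.≤ length Us →
           (∀ Rs → Rs Sublist.⊆ Us → Rs ≢ [] →
              ∃ λ F′ → Star ((G [ F ∪ ⋃ Rs ]) ⊢_⟶_) F F′ × Wins q G k F′) →
           Wins q G k F

IsZ : ℕ → Graph n → ℕ → Set
IsZ q G = IsLeast ℕ._≤_ (λ k → Wins q G k ⊥)

PathFrom : Graph n → Fin n → List (Fin n) → Set
PathFrom S v P = IsPath S P × ∃ λ vs → P ≡ v ∷ vs

-- Listing vertices from v on, a path with endpoint v is contained in another
-- one exactly if it is a prefix of it.
MaximalPathFrom : Graph n → Fin n → List (Fin n) → Set
MaximalPathFrom S v P =
  PathFrom S v P ×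
  ¬ ∃ λ Q → PathFrom S v Q × Prefix _≡_ P Q × length P ℕ.< length Q

weight : Graph n → List (Fin n) → ℤ
weight S P = foldr ℤ._+_ (+ 0) (map (λ w → + deg S w ℤ.- + 2) P)

IsMinWeight : Graph n → Fin n → ℤ → Set
IsMinWeight S v =
  IsLeast ℤ._≤_ λ x → ∃ λ P → MaximalPathFrom S v P × x ≡ weight S P

IsMaxMinWeight : Graph n → Fin n → ℤ → Set₁
IsMaxMinWeight T v =
  IsGreatest ℤ._≤_ λ x → ∃ λ S → S ⊑ T × Connected S × v ∈ V S × IsMinWeight S v x

IsMaxMaxMinWeight : Graph n → ℤ → Set₁
IsMaxMaxMinWeight T =
  IsGreatest ℤ._≤_ λ x → ∃ λ v → v ∈ V T × IsMaxMinWeight T v x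

{-# OPTIONS --safe #-}
module Submission where

-- For a subtree S rooted at v, the minimum over the maximal paths P from v of
-- ∑ (deg w - 2), plus 2, is the minimum over the paths from v to a leaf of
-- ∑ (c w - 1), where w ranges over the inner vertices and c w is the number of
-- children of w. Call this the value of (S , v), and call (S , v) clear if no
-- filled vertex lies in a branch of T - v that contains a child of v. The game
-- value of a position is the largest value of a clear pair.
--
-- Lower bound: a token lowers the value of a clear pair by at most 1 (cut off
-- the child branch of v that it lands in; if there is only one, move the root
-- into that branch first, at no loss). Forcing does not lower it. The oracle
-- answers with a component that contains no child of v, or, if two announced
-- components contain children of v, with both of them, and then nothing can be
-- forced.
--
-- Upper bound: with two filled vertices next to unfilled ones, the player forces
-- for free, possibly after announcing two components. Otherwise one filled
-- vertex p separates the unfilled branches. From p, walk to a leaf, always to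
-- the child whose branch has the largest value. A clear pair of maximal value
-- that avoids the direction of this leaf could be extended by the chosen branch
-- to a clear pair of larger value; so a token on the leaf lowers the maximum.

open import Defs
open import Data.Empty using (⊥-elim)
open import Data.Fin.Base using (Fin; zero; suc)
open import Data.Fin.Properties using (_≟_; any?)
open import Data.Fin.Subset
  using (Subset; _∈_; _∉_; _⊆_; ⊥; ⊤; ⁅_⁆; ∁; _∩_; _∪_; ⋃; _-_; ∣_∣; Nonempty; inside; outside)
open import Data.Fin.Subset.Properties
open import Data.Integer.Base as ℤ using (ℤ; +_; _+_)
import Data.Integer.Properties as ℤ
open import Data.Integer.Tactic.RingSolver using (solve-∀)
open import Data.List.Base using (List; []; _∷_; _∷ʳ_; length)
open import Data.List.Membership.Propositional using () renaming (_∈_ to _∈ˡ_)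
open import Data.List.Membership.DecPropositional using () renaming (_∈?_ to ∈ˡ?)
open import Data.List.Relation.Binary.Prefix.Heterogeneous using (Prefix; []; _∷_)
import Data.List.Relation.Binary.Sublist.Propositional as Sublist
open Sublist using (_∷_)
open import Data.List.Relation.Unary.All as All using (All; []; _∷_)
open import Data.List.Relation.Unary.All.Properties using (¬Any⇒All¬)
open import Data.List.Relation.Unary.AllPairs using ([]; _∷_)
open import Data.List.Relation.Unary.Any using (here; there)
open import Data.List.Relation.Unary.Linked using (Linked; []; [-]; _∷_)
open import Data.List.Relation.Unary.Unique.Propositional using (Unique)
open import Data.Nat.Base as ℕ using (ℕ; zero; suc; _≤_; _<_; z≤n; s≤s)
import Data.Nat.Properties as ℕ
open import Data.Product.Base using (∃; ∃₂; _×_; _,_; proj₁; proj₂)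
open import Data.Sum.Base using (_⊎_; inj₁; inj₂)
open import Data.Vec.Base as Vec using (tabulate; _∷_; [])
open import Data.Vec.Properties using (lookup∘tabulate; lookup⇒[]=; []=⇒lookup)
open import Function.Base using (_∘_; id; case_of_)
open import Induction.WellFounded using (Acc; acc)
open import Level using (0ℓ)
open import Relation.Binary.Construct.Closure.ReflexiveTransitive
  using (Star; ε; _◅_; _◅◅_; reverse)
  renaming (map to Star-map)
open import Relation.Binary.Core using (Rel)
open import Relation.Binary.PropositionalEquality
  using (_≡_; _≢_; refl; sym; trans; cong; cong₂; subst; subst₂; ≢-sym; module ≡-Reasoning)
open import Relation.Nullary using (¬_; Dec; yes; no; does; ¬?; _×-dec_; _⊎-dec_)
open import Relation.Nullary.Decidable using (dec-true; map′)
open import Relation.Unary using (Pred) renaming (Decidable to Decidable₁)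

private
  variable
    n : ℕ

-- Finite sets

⟦_⟧ : {P : Pred (Fin n) 0ℓ} → Decidable₁ P → Subset n
⟦ P? ⟧ = tabulate (does ∘ P?)

module _ {P : Pred (Fin n) 0ℓ} (P? : Decidable₁ P) where

  ∈⟦⟧⁺ : ∀ {x} → P x → x ∈ ⟦ P? ⟧
  ∈⟦⟧⁺ {x} px =
    lookup⇒[]= x _ (trans (lookup∘tabulate (does ∘ P?) x) (dec-true (P? x) px))

  ∈⟦⟧⁻ : ∀ {x} → x ∈ ⟦ P? ⟧ → P x
  ∈⟦⟧⁻ {x} x∈ with P? x | trans (sym (lookup∘tabulate (does ∘ P?) x)) ([]=⇒lookup x∈)
  ... | yes px | _ = px

∣p∣≤1+∣p-x∣ : ∀ (p : Subset n) x → ∣ p ∣ ≤ suc ∣ p - x ∣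
∣p∣≤1+∣p-x∣ (s ∷ p) zero = subst (λ q → ∣ s ∷ p ∣ ≤ suc ∣ q ∣) (sym (p─⊥≡p p)) (go s)
  where
  go : ∀ s → ∣ s ∷ p ∣ ≤ suc ∣ p ∣
  go inside  = ℕ.≤-refl
  go outside = ℕ.n≤1+n _
∣p∣≤1+∣p-x∣ (inside  ∷ p) (suc x) = s≤s (∣p∣≤1+∣p-x∣ p x)
∣p∣≤1+∣p-x∣ (outside ∷ p) (suc x) = ∣p∣≤1+∣p-x∣ p x

x∉p-x : ∀ (p : Subset n) x → x ∉ p - x
x∉p-x (_ ∷ p) (suc x) (Vec.there x∈) = x∉p-x p x x∈

x∈p-y⇒x≢y : ∀ {p : Subset n} {x y} → x ∈ p - y → x ≢ y
x∈p-y⇒x≢y {p = p} {x} x∈ refl = x∉p-x p x x∈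

∣p∣<∣p∪⁅x⁆∣ : ∀ {p : Subset n} {x} → x ∉ p → ∣ p ∣ < ∣ p ∪ ⁅ x ⁆ ∣
∣p∣<∣p∪⁅x⁆∣ {p = p} {x} x∉p =
  p⊂q⇒∣p∣<∣q∣ (p⊆p∪q ⁅ x ⁆ , x , q⊆p∪q p ⁅ x ⁆ (x∈⁅x⁆ x) , x∉p)

x∈p∪⁅y⁆⁻ : ∀ {p : Subset n} {x y} → x ∈ p ∪ ⁅ y ⁆ → x ∈ p ⊎ x ≡ y
x∈p∪⁅y⁆⁻ {p = p} {y = y} x∈ with x∈p∪q⁻ p ⁅ y ⁆ x∈
... | inj₁ x∈p = inj₁ x∈p
... | inj₂ x∈y = inj₂ (x∈⁅y⁆⇒x≡y y x∈y)

x∈p∪⁅x⁆ : ∀ {p : Subset n} {x} → x ∈ p ∪ ⁅ x ⁆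
x∈p∪⁅x⁆ {p = p} {x} = q⊆p∪q p ⁅ x ⁆ (x∈⁅x⁆ x)

Nonempty⇒1≤∣p∣ : ∀ {p : Subset n} → Nonempty p → 1 ≤ ∣ p ∣
Nonempty⇒1≤∣p∣ {p = p} (x , x∈p) =
  ℕ.≤-trans (ℕ.≤-reflexive (sym (∣⁅x⁆∣≡1 x)))
            (p⊆q⇒∣p∣≤∣q∣ λ y∈ → subst (_∈ p) (sym (x∈⁅y⁆⇒x≡y x y∈)) x∈p)

1≤∣p∣⇒Nonempty : ∀ {p : Subset n} → 1 ≤ ∣ p ∣ → Nonempty p
1≤∣p∣⇒Nonempty {n} {p} 1≤ with nonempty? p
... | yes p≢∅ = p≢∅
... | no p≡∅ = ⊥-elim (ℕ.<⇒≱ 1≤ (ℕ.≤-reflexive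
  (trans (cong ∣_∣ (Empty-unique p≡∅)) (∣⊥∣≡0 n))))

p⊆⁅x⁆⇒∣p∣≤1 : ∀ {p : Subset n} {x} → (∀ {y} → y ∈ p → y ≡ x) → ∣ p ∣ ≤ 1
p⊆⁅x⁆⇒∣p∣≤1 {p = p} {x} all≡ = ℕ.≤-trans
  (p⊆q⇒∣p∣≤∣q∣ λ y∈ → subst (_∈ ⁅ x ⁆) (sym (all≡ y∈)) (x∈⁅x⁆ x))
  (ℕ.≤-reflexive (∣⁅x⁆∣≡1 x))

+2-cancel-≤ : ∀ {x y} → x + + 2 ℤ.≤ y + + 2 → x ℤ.≤ y
+2-cancel-≤ {x} {y} le = subst₂ ℤ._≤_ (cancel x) (cancel y) (ℤ.+-monoˡ-≤ (ℤ.- + 2) le)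
  where
  cancel : ∀ x → (x + + 2) + ℤ.- + 2 ≡ x
  cancel = solve-∀

-- Neither alternative need be decidable: `f` picks a side at each index, and the search returns the
-- first index, if any, where it picked `A`.
⊎-search : ∀ {a b} {A : Fin n → Set a} {B : Fin n → Set b} →
           (∀ i → A i ⊎ B i) → ∃ A ⊎ (∀ i → B i)
⊎-search {zero}  f = inj₂ λ ()
⊎-search {suc n} f with f zero | ⊎-search (f ∘ suc)
... | inj₁ a | _              = inj₁ (zero , a)
... | inj₂ _ | inj₁ (i , a)   = inj₁ (suc i , a)
... | inj₂ b | inj₂ bs        = inj₂ λ { zero → b ; (suc i) → bs i }

-- Walks

module _ {R : Rel (Fin n) 0ℓ} where

  cut-at-first-visit : ∀ {z u} → Star R z u → z ≢ u →
    ∃ λ e → R e u × Star (λ x y → R x y × x ≢ u × y ≢ u) z e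
  cut-at-first-visit ε z≢z = ⊥-elim (z≢z refl)
  cut-at-first-visit {z} {u} (_◅_ {j = y} r rs) z≢u with y ≟ u
  ... | yes refl = z , r , ε
  ... | no y≢u with cut-at-first-visit rs y≢u
  ...   | e , Reu , st = e , Reu , (r , z≢u , y≢u) ◅ st

  -- The list omits the starting vertex: the vertices of a path from `x` are `x ∷ vs`.
  data SimplePath : Fin n → Fin n → List (Fin n) → Set where
    stop : ∀ {x} → SimplePath x x []
    step : ∀ {x x′ y vs} → R x x′ → All (x ≢_) (x′ ∷ vs) → SimplePath x′ y vs →
           SimplePath x y (x′ ∷ vs)

  suffix-from : ∀ {x x′ y vs} → SimplePath x′ y vs → x ∈ˡ x′ ∷ vs → ∃ (SimplePath x y)
  suffix-from p            (here refl) = _ , p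
  suffix-from (step _ _ p) (there x∈)  = suffix-from p x∈

  loop-erase : ∀ {x y} → Star R x y → ∃ (SimplePath x y)
  loop-erase ε = [] , stop
  loop-erase {x} (_◅_ {j = x′} r rs) with loop-erase rs
  ... | vs , p with ∈ˡ? _≟_ x (x′ ∷ vs)
  ...   | yes x∈ = suffix-from p x∈
  ...   | no x∉  = _ , step r (¬Any⇒All¬ _ x∉) p

  SimplePath⇒Unique : ∀ {x y vs} → SimplePath x y vs → Unique (x ∷ vs)
  SimplePath⇒Unique stop         = [] ∷ []
  SimplePath⇒Unique (step _ x≢ p) = x≢ ∷ SimplePath⇒Unique p

-- Components

x∈⋃⁻ : ∀ {x : Fin n} Rs → x ∈ ⋃ Rs → ∃ λ R → R ∈ˡ Rs × x ∈ R
x∈⋃⁻ [] x∈ = ⊥-elim (∉⊥ x∈)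
x∈⋃⁻ (R ∷ Rs) x∈ with x∈p∪q⁻ R (⋃ Rs) x∈
... | inj₁ x∈R = R , here refl , x∈R
... | inj₂ x∈Rs = let R′ , R′∈ , x∈R′ = x∈⋃⁻ Rs x∈Rs in R′ , there R′∈ , x∈R′

x∈⋃⁺ : ∀ {x : Fin n} {R Rs} → R ∈ˡ Rs → x ∈ R → x ∈ ⋃ Rs
x∈⋃⁺ {Rs = R ∷ Rs} (here refl) x∈R = p⊆p∪q (⋃ Rs) x∈R
x∈⋃⁺ {Rs = R ∷ Rs} (there R∈)  x∈R = q⊆p∪q R (⋃ Rs) (x∈⋃⁺ R∈ x∈R)

∣∁[p∪⁅x⁆]∣<∣∁p∣ : ∀ {p : Subset n} {x} → x ∉ p → ∣ ∁ (p ∪ ⁅ x ⁆) ∣ < ∣ ∁ p ∣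
∣∁[p∪⁅x⁆]∣<∣∁p∣ {p = p} {x} x∉p =
  p⊂q⇒∣p∣<∣q∣ (p⊂q⇒∁p⊃∁q (p⊆p∪q ⁅ x ⁆ , x , x∈p∪⁅x⁆ , x∉p))

connected-from : ∀ (H : Graph n) {c} → c ∈ Graph.V H →
                 (∀ z → z ∈ Graph.V H → Star (Graph._~_ H) c z) → Connected H
connected-from H c∈V reach = (_ , c∈V) , λ {u} {v} u∈V v∈V →
  reverse (Graph.~-sym H) (reach u u∈V) ◅◅ reach v v∈V

module _ (H : Graph n) where

  open Graph H

  Connected-∪ : ∀ {U w y} → Connected (H [ U ]) → w ∈ U → w ~ y →
                Connected (H [ U ∪ ⁅ y ⁆ ])
  Connected-∪ {U} {w} {y} (_ , walk) w∈U w~y =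
    connected-from (H [ U ∪ ⁅ y ⁆ ]) (x∈p∩q⁺ (~⇒∈V w~y , U⊆ w∈U)) reach
    where
    U⊆ : U ⊆ U ∪ ⁅ y ⁆
    U⊆ = p⊆p∪q ⁅ y ⁆
    reach : ∀ z → z ∈ V ∩ (U ∪ ⁅ y ⁆) → Star (Graph._~_ (H [ U ∪ ⁅ y ⁆ ])) w z
    reach z z∈ with x∈p∩q⁻ V (U ∪ ⁅ y ⁆) z∈
    ... | z∈V , z∈U∪y with x∈p∪⁅y⁆⁻ {p = U} z∈U∪y
    ...   | inj₂ refl = (U⊆ w∈U , x∈p∪⁅x⁆ {p = U} , w~y) ◅ ε
    ...   | inj₁ z∈U = Star-map (λ (a , b , a~b) → U⊆ a , U⊆ b , a~b)
                         (walk (x∈p∩q⁺ (~⇒∈V w~y , w∈U)) (x∈p∩q⁺ (z∈V , z∈U)))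

  component-walk : ∀ {U u v} → IsComponent H U → u ∈ U → v ∈ U →
                   Star (Graph._~_ (H [ U ])) u v
  component-walk (U⊆V , (_ , walk) , _) u∈U v∈U =
    walk (x∈p∩q⁺ (U⊆V u∈U , u∈U)) (x∈p∩q⁺ (U⊆V v∈U , v∈U))

  -- Adding `v` to `U` keeps it connected, so maximality already puts `v` in `U`.
  component-closed : ∀ {U u v} → IsComponent H U → u ∈ U → u ~ v → v ∈ U
  component-closed {U} {u} {v} (U⊆V , conn , maximal) u∈U u~v =
    maximal (U ∪ ⁅ v ⁆) ⊆V (Connected-∪ conn u∈U u~v) (p⊆p∪q ⁅ v ⁆) (x∈p∪⁅x⁆ {p = U})
    where
    ⊆V : U ∪ ⁅ v ⁆ ⊆ V
    ⊆V z∈ with x∈p∪⁅y⁆⁻ {p = U} z∈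
    ... | inj₁ z∈U = U⊆V z∈U
    ... | inj₂ refl = ~⇒∈V (~-sym u~v)

  component-closed* : ∀ {U u v} → IsComponent H U → u ∈ U → Star _~_ u v → v ∈ U
  component-closed* comp u∈U ε = u∈U
  component-closed* comp u∈U (u~w ◅ st) =
    component-closed* comp (component-closed comp u∈U u~w) st

  components-meeting⇒⊆ : ∀ {U U′ u} → IsComponent H U → IsComponent H U′ →
                         u ∈ U → u ∈ U′ → U ⊆ U′
  components-meeting⇒⊆ comp comp′ u∈U u∈U′ z∈U =
    component-closed* comp′ u∈U′ (Star-map (proj₂ ∘ proj₂) (component-walk comp u∈U z∈U))

  -- Grow a connected set from `z` by one adjacent outside vertex at a time; `m` bounds the number
  -- of vertices outside. Once no outside vertex is adjacent, every walk from `z` stays inside,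
  -- which gives maximality.
  component-of : ∀ {z} → z ∈ V → ∃ λ U → IsComponent H U × z ∈ U
  component-of {z} z∈V = grow _ ℕ.≤-refl ⊆V single (x∈⁅x⁆ z)
    where
    ⊆V : ⁅ z ⁆ ⊆ V
    ⊆V x∈ = subst (_∈ V) (sym (x∈⁅y⁆⇒x≡y z x∈)) z∈V
    single : Connected (H [ ⁅ z ⁆ ])
    single = (z , x∈p∩q⁺ (z∈V , x∈⁅x⁆ z)) , λ u∈ v∈ →
      subst (λ w → Star _ w _) (sym (≡z u∈)) (subst (Star _ z) (sym (≡z v∈)) ε)
      where
      ≡z : ∀ {u} → u ∈ V ∩ ⁅ z ⁆ → u ≡ z
      ≡z u∈ = x∈⁅y⁆⇒x≡y z (proj₂ (x∈p∩q⁻ V ⁅ z ⁆ u∈))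
    grow : ∀ m {U} → ∣ ∁ U ∣ ≤ m → U ⊆ V → Connected (H [ U ]) → z ∈ U →
           ∃ λ U → IsComponent H U × z ∈ U
    grow m {U} ∣∁U∣≤ U⊆V conn z∈U
      with any? (λ y → ¬? (y ∈? U) ×-dec any? (λ w → (w ∈? U) ×-dec (w ~? y)))
    ... | no none = U , (U⊆V , conn , maximal) , z∈U
      where
      closed : ∀ {W x y} → x ∈ U → Star (Graph._~_ (H [ W ])) x y → y ∈ U
      closed x∈U ε = x∈U
      closed {x = x} x∈U (_◅_ {j = y} (_ , _ , x~y) st) with y ∈? U
      ... | yes y∈U = closed y∈U st
      ... | no y∉U = ⊥-elim (none (y , y∉U , x , x∈U , x~y))
      maximal : ∀ W → W ⊆ V → Connected (H [ W ]) → U ⊆ W → W ⊆ U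
      maximal W W⊆V (_ , walk) U⊆W x∈W =
        closed {W} z∈U (walk (x∈p∩q⁺ (U⊆V z∈U , U⊆W z∈U)) (x∈p∩q⁺ (W⊆V x∈W , x∈W)))
    grow zero ∣∁U∣≤ _ _ _ | yes (y , y∉U , _) =
      ⊥-elim (ℕ.<⇒≱ (Nonempty⇒1≤∣p∣ (y , x∉p⇒x∈∁p y∉U)) ∣∁U∣≤)
    grow (suc m) {U} ∣∁U∣≤ U⊆V conn z∈U | yes (y , y∉U , w , w∈U , w~y) =
      grow m (ℕ.≤-pred (ℕ.≤-trans (∣∁[p∪⁅x⁆]∣<∣∁p∣ y∉U) ∣∁U∣≤)) U∪y⊆V
           (Connected-∪ conn w∈U w~y) (p⊆p∪q ⁅ y ⁆ z∈U)
      where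
      U∪y⊆V : U ∪ ⁅ y ⁆ ⊆ V
      U∪y⊆V x∈ with x∈p∪⁅y⁆⁻ {p = U} x∈
      ... | inj₁ x∈U = U⊆V x∈U
      ... | inj₂ refl = ~⇒∈V (~-sym w~y)

-- Paths

module _ {n} (S : Graph n) where

  open Graph S

  -- The cardinality of this set unfolds to `deg S w`.
  neighbors : Fin n → Subset n
  neighbors w = ⟦ w ~?_ ⟧

  children : Fin n → Fin n → Subset n
  children p w = neighbors w - p

  ∈children⁺ : ∀ {p w e} → w ~ e → e ≢ p → e ∈ children p w
  ∈children⁺ {w = w} w~e e≢p = x∈p∧x≢y⇒x∈p-y (∈⟦⟧⁺ (w ~?_) w~e) e≢p

  ∈children⁻ : ∀ {p w e} → e ∈ children p w → w ~ e × e ≢ p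
  ∈children⁻ {p} {w} e∈ =
    ∈⟦⟧⁻ (w ~?_) (p─q⊆p (neighbors w) ⁅ p ⁆ e∈) , x∈p-y⇒x≢y {p = neighbors w} e∈

  -- Down p w P c: the path P leads from w to a leaf without visiting p first,
  -- and c is the sum of (number of children) - 1 over its vertices but the
  -- leaf. A root w is its own p, as w is not a neighbor of w.
  data Down : Fin n → Fin n → List (Fin n) → ℕ → Set where
    stop : ∀ {p w} → (∀ {e} → w ~ e → e ≡ p) → Down p w (w ∷ []) 0
    step : ∀ {p w e P c} → w ~ e → e ≢ p → Down w e P c →
           Down p w (w ∷ P) (ℕ.pred ∣ children p w ∣ ℕ.+ c)

  -- A trail never turns straight back. In a tree this already makes its vertices distinct, so
  -- inductions along it need not carry `Unique`.
  data Trail : Fin n → Fin n → List (Fin n) → Set where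
    end  : ∀ {p w} → Trail p w (w ∷ [])
    next : ∀ {p w e P} → w ~ e → e ≢ p → Trail w e P → Trail p w (w ∷ P)

  Down⇒Trail : ∀ {p w P c} → Down p w P c → Trail p w P
  Down⇒Trail (stop _) = end
  Down⇒Trail (step w~e e≢p D) = next w~e e≢p (Down⇒Trail D)

  private
    same-head : ∀ {p w p′ w′ P Q c} → Down p w P c → Trail p′ w′ Q → Prefix _≡_ P Q → w ≡ w′
    same-head (stop _)     end          (w≡w′ ∷ _) = w≡w′
    same-head (stop _)     (next _ _ _) (w≡w′ ∷ _) = w≡w′
    same-head (step _ _ _) end          (w≡w′ ∷ _) = w≡w′
    same-head (step _ _ _) (next _ _ _) (w≡w′ ∷ _) = w≡w′

  Down-not-extendable : ∀ {p w P Q c} → Down p w P c → Trail p w Q → Prefix _≡_ P Q →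
                        ¬ length P < length Q
  Down-not-extendable (stop only-p) (next w~e e≢p _) _ _ = e≢p (only-p w~e)
  Down-not-extendable (stop _) end _ (s≤s ())
  Down-not-extendable (step _ _ _) end _ (s≤s ())
  Down-not-extendable (step _ _ D) (next _ _ t) (_ ∷ pre) (s≤s lt) with same-head D t pre
  ... | refl = Down-not-extendable D t pre lt

  -- A neighbor of the last vertex other than its predecessor would prolong the trail, so the last
  -- vertex is a leaf.
  unextendable⇒Down : ∀ {p w P} → Trail p w P →
    (∀ {Q} → Trail p w Q → Prefix _≡_ P Q → ¬ length P < length Q) → ∃ (Down p w P)
  unextendable⇒Down {p} end maximal = 0 , stop λ {e} w~e → case e ≟ p of λ
    { (yes e≡p) → e≡p
    ; (no e≢p) → ⊥-elim (maximal (next w~e e≢p end) (refl ∷ []) (s≤s (s≤s z≤n))) }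
  unextendable⇒Down (next w~e e≢p t) maximal
    with unextendable⇒Down t (λ t′ pre lt → maximal (next w~e e≢p t′) (refl ∷ pre) (s≤s lt))
  ... | _ , D = _ , step w~e e≢p D

  path⇒Trail : ∀ {p w vs} → Linked _~_ (w ∷ vs) → Unique (w ∷ vs) → All (p ≢_) vs →
               Trail p w (w ∷ vs)
  path⇒Trail {vs = []} _ _ _ = end
  path⇒Trail {vs = _ ∷ _} (w~e ∷ l) (w∉ ∷ u) (p≢e ∷ _) =
    next w~e (≢-sym p≢e) (path⇒Trail l u (All.tail w∉))

  Trail⇒Linked : ∀ {p w P} → Trail p w P → Linked _~_ P
  Trail⇒Linked end = [-]
  Trail⇒Linked (next w~e _ end) = w~e ∷ [-]
  Trail⇒Linked (next w~e _ t@(next _ _ _)) = w~e ∷ Trail⇒Linked t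

  Trail⇒∈V : ∀ {p w P} → w ∈ V → Trail p w P → All (_∈ V) P
  Trail⇒∈V w∈V end = w∈V ∷ []
  Trail⇒∈V w∈V (next w~e _ t) = w∈V ∷ Trail⇒∈V (~⇒∈V (~-sym w~e)) t

  private
    weight-step : ∀ {d W : ℤ} b c δ → d ≡ + suc b + + δ → W + + 2 ≡ + c + + 1 →
                  ((d ℤ.- + 2) + W) + + 2 ≡ + b + + c + + δ
    weight-step {d} {W} b c δ d≡ W≡ = begin
      ((d ℤ.- + 2) + W) + + 2                     ≡⟨ ℤ.+-assoc (d ℤ.- + 2) W (+ 2) ⟩
      (d ℤ.- + 2) + (W + + 2)                     ≡⟨ cong₂ (λ x y → (x ℤ.- + 2) + y) d≡ W≡ ⟩
      ((+ 1 + + b + + δ) ℤ.- + 2) + (+ c + + 1)   ≡⟨ regroup (+ b) (+ c) (+ δ) ⟩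
      + b + + c + + δ                             ∎
      where
      open ≡-Reasoning
      regroup : ∀ b c δ → ((+ 1 + b + δ) ℤ.- + 2) + (c + + 1) ≡ b + c + δ
      regroup = solve-∀

  deg-nonroot : ∀ {p w} → w ~ p → deg S w ≡ ∣ children p w ∣ ℕ.+ 1
  deg-nonroot {p} {w} w~p = trans
    (ℕ.≤-antisym (∣p∣≤1+∣p-x∣ (neighbors w) p) (x∈p⇒∣p-x∣<∣p∣ (∈⟦⟧⁺ (w ~?_) w~p)))
    (ℕ.+-comm 1 _)

  deg-root : ∀ {v} → deg S v ≡ ∣ children v v ∣ ℕ.+ 0
  deg-root {v} = trans
    (ℕ.≤-antisym
      (p⊆q⇒∣p∣≤∣q∣ {p = neighbors v} {q = children v v} λ e∈ →
        x∈p∧x≢y⇒x∈p-y e∈ λ { refl → ~-irrefl (∈⟦⟧⁻ (v ~?_) e∈) })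
      (p⊆q⇒∣p∣≤∣q∣ {p = children v v} {q = neighbors v} (p─q⊆p (neighbors v) ⁅ v ⁆)))
    (sym (ℕ.+-identityʳ ∣ children v v ∣))

  -- Here `δ` is 1 if `w` has a parent and 0 if it is the root. An inner vertex below the root has
  -- one more neighbor than children, so its degree minus 2 is its share of `c`. The missing parent
  -- edge of the root and the missing children of the leaf account for the 2.
  Down⇒weight : ∀ {p w P c δ} → deg S w ≡ ∣ children p w ∣ ℕ.+ δ → Down p w P c →
                weight S P + + 2 ≡ + (c ℕ.+ δ)
  Down⇒weight {p} {w} {δ = δ} deg≡ (stop only-p) = begin
    ((+ deg S w ℤ.- + 2) + + 0) + + 2  ≡⟨ cong (λ d → ((+ d ℤ.- + 2) + + 0) + + 2) deg≡δ ⟩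
    ((+ δ ℤ.- + 2) + + 0) + + 2        ≡⟨ cancel (+ δ) ⟩
    + δ                                ∎
    where
    open ≡-Reasoning
    cancel : ∀ x → ((x ℤ.- + 2) + + 0) + + 2 ≡ x
    cancel = solve-∀
    deg≡δ : deg S w ≡ δ
    deg≡δ = trans deg≡ (cong (ℕ._+ δ) (trans
      (cong ∣_∣ (Empty-unique λ (e , e∈) →
        let w~e , e≢p = ∈children⁻ {p} {w} e∈ in e≢p (only-p w~e)))
      (∣⊥∣≡0 n)))
  Down⇒weight {p} {w} {δ = δ} deg≡ (step {e = e} {c = c} w~e e≢p D) =
    weight-step (ℕ.pred ∣ children p w ∣) c δ
      (cong +_ (trans deg≡ (cong (ℕ._+ δ) ∣children∣≡)))
      (Down⇒weight (deg-nonroot (~-sym w~e)) D)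
    where
    -- The child `e` makes the count positive, so `pred` does not truncate.
    ∣children∣≡ : ∣ children p w ∣ ≡ suc (ℕ.pred ∣ children p w ∣)
    ∣children∣≡ with ∣ children p w ∣ | Nonempty⇒1≤∣p∣ (e , ∈children⁺ w~e e≢p)
    ... | suc _ | _ = refl

-- Branches of a tree

module Tree {n : ℕ} (T : Graph n) (T-tree : IsTree T) where

  open Graph T

  connected : ∀ {u v} → u ∈ V → v ∈ V → Star _~_ u v
  connected = proj₂ (proj₁ T-tree)

  ~⇒≢ : ∀ {u v} → u ~ v → u ≢ v
  ~⇒≢ u~u refl = ~-irrefl u~u

  ~⇒∈V′ : ∀ {u v} → u ~ v → v ∈ V
  ~⇒∈V′ u~v = ~⇒∈V (~-sym u~v)

  Avoiding : Fin n → Rel (Fin n) 0ℓ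
  Avoiding u x y = x ~ y × x ≢ u × y ≢ u

  Avoiding-sym : ∀ {u x y} → Avoiding u x y → Avoiding u y x
  Avoiding-sym (x~y , x≢u , y≢u) = ~-sym x~y , y≢u , x≢u

  -- For adjacent u and d, the component of T - u that contains d.
  Branch : Fin n → Fin n → Pred (Fin n) 0ℓ
  Branch u d z = Star (Avoiding u) d z

  -- A path that joins two different neighbors of `u` and avoids `u` closes to a cycle through `u`.
  neighbors-joined⇒≡ : ∀ {u d d′} → u ~ d → u ~ d′ → Branch u d d′ → d ≡ d′
  neighbors-joined⇒≡ {u} {d} {d′} u~d u~d′ walk with d ≟ d′ | loop-erase walk
  ... | yes d≡d′ | _ = d≡d′
  ... | no d≢d′ | [] , stop = ⊥-elim (d≢d′ refl)
  ... | no d≢d′ | x ∷ vs , p =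
    ⊥-elim (proj₂ T-tree (u , d ∷ x ∷ vs , s≤s (s≤s (s≤s z≤n)) , u~d ∷ links p ,
                          misses (≢-sym (~⇒≢ u~d)) p ∷ SimplePath⇒Unique p))
    where
    links : ∀ {x vs} → SimplePath {R = Avoiding u} x d′ vs → Linked _~_ ((x ∷ vs) ∷ʳ u)
    links stop = ~-sym u~d′ ∷ [-]
    links (step (x~y , _) _ p) = x~y ∷ links p
    misses : ∀ {x vs} → x ≢ u → SimplePath {R = Avoiding u} x d′ vs → All (u ≢_) (x ∷ vs)
    misses x≢u stop = ≢-sym x≢u ∷ []
    misses x≢u (step (_ , _ , y≢u) _ p) = ≢-sym x≢u ∷ misses y≢u p

  Branch-unique : ∀ {u d d′ z} → u ~ d → u ~ d′ → Branch u d z → Branch u d′ z → d ≡ d′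
  Branch-unique u~d u~d′ dz d′z =
    neighbors-joined⇒≡ u~d u~d′ (dz ◅◅ reverse Avoiding-sym d′z)

  branch-of : ∀ {u z} → u ∈ V → z ∈ V → z ≢ u → ∃ λ d → u ~ d × Branch u d z
  branch-of u∈V z∈V z≢u with cut-at-first-visit (connected z∈V u∈V) z≢u
  ... | e , e~u , st = e , ~-sym e~u , reverse Avoiding-sym st

  Branch-step : ∀ {u d x y} → u ~ d → Branch u d x → x ~ y → y ≢ u → Branch u d y
  Branch-step u~d ε x~y y≢u = (x~y , ≢-sym (~⇒≢ u~d) , y≢u) ◅ ε
  Branch-step u~d (a@(x~z , _ , z≢u) ◅ st) z~y y≢u = a ◅ go z≢u st z~y
    where
    go : ∀ {w x} → w ≢ _ → Star (Avoiding _) w x → x ~ _ → Star (Avoiding _) w _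
    go w≢u ε x~y = (x~y , w≢u , y≢u) ◅ ε
    go _ (a@(_ , _ , z≢u) ◅ st) x~y = a ◅ go z≢u st x~y

  Branch⇒≢ : ∀ {u d z} → u ~ d → Branch u d z → z ≢ u
  Branch⇒≢ u~d ε = ≢-sym (~⇒≢ u~d)
  Branch⇒≢ u~d ((x~y , _ , y≢u) ◅ st) = go y≢u st
    where
    go : ∀ {u w z} → w ≢ u → Star (Avoiding u) w z → z ≢ u
    go w≢u ε = w≢u
    go _ ((_ , _ , y≢u) ◅ st) = go y≢u st

  Branch⇒∈V : ∀ {u d z} → d ∈ V → Branch u d z → z ∈ V
  Branch⇒∈V d∈V ε = d∈V
  Branch⇒∈V _ ((x~y , _) ◅ st) = Branch⇒∈V (~⇒∈V′ x~y) st

  -- Connectedness names the branch at `u` that holds `z`; as branches are disjoint, comparing its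
  -- first vertex with `d` decides the question.
  Branch? : ∀ {u d} → u ~ d → Decidable₁ (Branch u d)
  Branch? {u} {d} u~d z with z ∈? V | z ≟ u
  ... | no z∉V | _ = no λ dz → z∉V (Branch⇒∈V (~⇒∈V′ u~d) dz)
  ... | yes z∈V | yes refl = no λ dz → Branch⇒≢ u~d dz refl
  ... | yes z∈V | no z≢u with branch-of (~⇒∈V u~d) z∈V z≢u
  ...   | d′ , u~d′ , d′z with d ≟ d′
  ...     | yes refl = yes d′z
  ...     | no d≢d′ = no λ dz → d≢d′ (Branch-unique u~d u~d′ dz d′z)

  -- A walk from `e` that avoids `d` cannot reach `p`, since `p` is itself a neighbor of `d` and
  -- starts another branch there.
  Branch-⊆ : ∀ {p d e z} → p ~ d → d ~ e → e ≢ p → Branch d e z → Branch p d z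
  Branch-⊆ {p} {d} {e} p~d d~e e≢p = go ε (Branch-step p~d ε d~e e≢p)
    where
    go : ∀ {x z} → Branch d e x → Branch p d x → Star (Avoiding d) x z → Branch p d z
    go ex dx ε = dx
    go {x} ex dx (_◅_ {j = y} a@(x~y , _ , y≢d) st) = go ey (Branch-step p~d dx x~y y≢p) st
      where
      ey : Branch d e y
      ey = Branch-step d~e ex x~y y≢d
      y≢p : y ≢ p
      y≢p refl = e≢p (Branch-unique d~e (~-sym p~d) ey ε)

  Branch-descend : ∀ {p d v} → p ~ d → Branch p d v → v ≢ d →
                   ∃ λ e → d ~ e × e ≢ p × Branch d e v
  Branch-descend p~d dv v≢d with cut-at-first-visit (reverse Avoiding-sym dv) v≢d
  ... | e , (e~d , e≢p , _) , st = e , ~-sym e~d , e≢p ,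
    reverse Avoiding-sym (Star-map (λ ((x~y , _) , x≢d , y≢d) → x~y , x≢d , y≢d) st)

  -- Passage from an edge to a child edge. Pairs need not be edges: `(v , v)` stands for the root
  -- `v`, in line with the convention for `Down`.
  _≺_ : Rel (Fin n × Fin n) 0ℓ
  (d′ , e) ≺ (p , d) = d′ ≡ d × d ~ e × e ≢ p

  private
    -- The branch of a child edge lies in the branch of `d` and misses `d`, so the enclosing set `X`
    -- can lose `d` at each step.
    ≺-acc-edge : ∀ m (X : Subset n) {p d} → ∣ X ∣ ≤ m → p ~ d →
                 (∀ {z} → Branch p d z → z ∈ X) → Acc _≺_ (p , d)
    ≺-acc-edge zero X ∣X∣≤0 p~d ⊆X =
      ⊥-elim (ℕ.<⇒≱ (Nonempty⇒1≤∣p∣ (_ , ⊆X ε)) ∣X∣≤0)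
    ≺-acc-edge (suc m) X {p} {d} ∣X∣≤ p~d ⊆X = acc λ { {d , e} (refl , d~e , e≢p) →
      ≺-acc-edge m (X - d) (ℕ.≤-pred (ℕ.≤-trans (x∈p⇒∣p-x∣<∣p∣ (⊆X ε)) ∣X∣≤)) d~e
        λ ez → x∈p∧x≢y⇒x∈p-y (⊆X (Branch-⊆ p~d d~e e≢p ez)) (Branch⇒≢ d~e ez) }

  ≺-acc : ∀ e → Acc _≺_ e
  ≺-acc (p , d) = acc λ { {d , e} (refl , d~e , _) →
    ≺-acc-edge _ ⊤ ℕ.≤-refl d~e λ _ → ∈⊤ }

  -- The walk from `p` by way of `d` to `x` misses `u`, so it never leaves the branch at `u` that
  -- contains `p`.
  Branch-through : ∀ {u e p d x} → u ~ e → Branch u e p → p ~ d → Branch p d x →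
                   ¬ Branch p d u → Branch u e x
  Branch-through {u} {e} {p} {d} u~e ep p~d dx u∉ = go ε (Branch-step u~e ep p~d d≢u) dx
    where
    d≢u : d ≢ u
    d≢u refl = u∉ ε
    go : ∀ {x y} → Branch p d x → Branch u e x → Star (Avoiding p) x y → Branch u e y
    go _ ex ε = ex
    go dx ex (_◅_ {j = z} (x~z , _ , z≢p) st) =
      go dz (Branch-step u~e ex x~z λ { refl → u∉ dz }) st
      where
      dz : Branch p d z
      dz = Branch-step p~d dx x~z z≢p

  -- A fan is a subtree S rooted at v, with the set C of children of v. Writing
  -- c w for the number of children of w in S, Fan k v C says that the sum of
  -- c w - 1 over the inner vertices of each path from v to a leaf of S is at
  -- least k; Rich k p d says that T - p contains such a subtree rooted at d.
  mutual

    data Rich : ℕ → Fin n → Fin n → Set where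
      leaf : ∀ {p d} → Rich 0 p d
      node : ∀ {k p d C} → p ∉ C → Fan k d C → Rich k p d

    data Fan : ℕ → Fin n → Subset n → Set where
      fan : ∀ {k v C} j → Nonempty C → (∀ {e} → e ∈ C → v ~ e × Rich j v e) →
            suc k ≤ ∣ C ∣ ℕ.+ j → Fan k v C

  Rich-≤ : ∀ {k k′ p d} → k′ ≤ k → Rich k p d → Rich k′ p d
  Rich-≤ z≤n _ = leaf
  Rich-≤ k′≤k@(s≤s _) (node p∉C (fan j C≢∅ f le)) =
    node p∉C (fan j C≢∅ f (ℕ.≤-trans (s≤s k′≤k) le))

  Fan⇒~ : ∀ {k v C e} → Fan k v C → e ∈ C → v ~ e
  Fan⇒~ (fan _ _ f _) e∈C = proj₁ (f e∈C)

  Fan-singleton : ∀ {k v e} → v ~ e → Rich k v e → Fan k v ⁅ e ⁆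
  Fan-singleton {k} {v} {e} v~e r = fan k (e , x∈⁅x⁆ e)
    (λ e′∈ → subst (λ e′ → v ~ e′ × Rich k v e′) (sym (x∈⁅y⁆⇒x≡y e e′∈)) (v~e , r))
    (ℕ.≤-reflexive (cong (ℕ._+ k) (sym (∣⁅x⁆∣≡1 e))))

  Fan-within-singleton : ∀ {k v C e} → Fan k v C → (∀ {e′} → e′ ∈ C → e′ ≡ e) →
                         e ∈ C × Rich k v e
  Fan-within-singleton (fan j (e′ , e′∈C) f le) all≡ with all≡ e′∈C
  ... | refl = e′∈C ,
    Rich-≤ (ℕ.≤-pred (ℕ.≤-trans le (ℕ.+-monoˡ-≤ j (p⊆⁅x⁆⇒∣p∣≤1 all≡)))) (proj₂ (f e′∈C))

  -- One more child raises the value by one, provided the new branch is as rich as the others are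
  -- required to be. Dominance is known only up to `k`, so the requirement `j` is first cut down to
  -- `k`; as `C` is nonempty, the value stays at least `k`.
  Fan-add : ∀ {k v C e c} → Fan k v C → e ∈ C → c ∉ C → v ~ c →
            (∀ {j} → j ≤ k → Rich j v e → Rich j v c) → Fan (suc k) v (C ∪ ⁅ c ⁆)
  Fan-add {k} {v} {C} {e} {c} (fan j C≢∅ f le) e∈C c∉C v~c dominates =
    fan (j ℕ.⊓ k) (_ , x∈p∪⁅x⁆) f′
        (ℕ.≤-trans (s≤s le′) (ℕ.+-monoˡ-≤ (j ℕ.⊓ k) (∣p∣<∣p∪⁅x⁆∣ c∉C)))
    where
    f″ : ∀ {e} → e ∈ C → v ~ e × Rich (j ℕ.⊓ k) v e
    f″ e∈C = proj₁ (f e∈C) , Rich-≤ (ℕ.m⊓n≤m j k) (proj₂ (f e∈C))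
    f′ : ∀ {e} → e ∈ C ∪ ⁅ c ⁆ → v ~ e × Rich (j ℕ.⊓ k) v e
    f′ e∈ with x∈p∪⁅y⁆⁻ {p = C} e∈
    ... | inj₁ e∈C = f″ e∈C
    ... | inj₂ refl = v~c , dominates (ℕ.m⊓n≤n j k) (proj₂ (f″ e∈C))
    le′ : suc k ≤ ∣ C ∣ ℕ.+ (j ℕ.⊓ k)
    le′ with ℕ.≤-total j k
    ... | inj₁ j≤k rewrite ℕ.m≤n⇒m⊓n≡m j≤k = le
    ... | inj₂ k≤j rewrite ℕ.m≥n⇒m⊓n≡n k≤j = ℕ.+-monoˡ-≤ k (Nonempty⇒1≤∣p∣ C≢∅)

  -- Hang the fan below the path from `d` to `v`. Each vertex on the way has a single child and
  -- contributes 1 - 1 = 0.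
  Rich-lift : ∀ {k p d v C} → Acc _≺_ (p , d) → p ~ d → Branch p d v →
              Fan k v C → (∀ {e} → e ∈ C → ¬ Branch v e p) → Rich k p d
  Rich-lift {p = p} {d} {v} (acc rs) p~d dv F away with v ≟ d
  ... | yes refl = node (λ p∈C → away p∈C ε) F
  ... | no v≢d with Branch-descend p~d dv v≢d
  ...   | e , d~e , e≢p , ev =
    node (λ p∈ → e≢p (sym (x∈⁅y⁆⇒x≡y e p∈)))
      (Fan-singleton d~e (Rich-lift (rs (refl , d~e , e≢p)) d~e ev F λ e′∈C e′d →
        away e′∈C (Branch-step (Fan⇒~ F e′∈C) e′d (~-sym p~d) (≢-sym (Branch⇒≢ p~d dv)))))

  child? : ∀ p d → Decidable₁ (λ e → d ~ e × e ≢ p)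
  child? p d e = (d ~? e) ×-dec ¬? (e ≟ p)

  child-Rich? : ∀ p d → (∀ {e} → d ~ e → e ≢ p → ∀ k → Dec (Rich k d e)) →
                ∀ j e → Dec ((d ~ e × e ≢ p) × Rich j d e)
  child-Rich? p d rec j e with child? p d e
  ... | no ¬child = no (¬child ∘ proj₁)
  ... | yes (d~e , e≢p) = map′ ((d~e , e≢p) ,_) proj₂ (rec d~e e≢p j)

  -- For a given `j` the best set of children consists of all that are rich to degree `j`. Values of
  -- `j` above `suc k` need no trial, because one child of richness `suc k` suffices.
  Rich?-acc : ∀ {p d} → Acc _≺_ (p , d) → ∀ k → Dec (Rich k p d)
  Rich?-acc _ zero = yes leaf
  Rich?-acc {p} {d} (acc rs) (suc k) = map′ to from
    (ℕ.anyUpTo? (λ j → nonempty? (Cs j) ×-dec suc (suc k) ℕ.≤? ∣ Cs j ∣ ℕ.+ j) (suc (suc k)))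
    where
    C? : ∀ j → Decidable₁ (λ e → (d ~ e × e ≢ p) × Rich j d e)
    C? = child-Rich? p d λ d~e e≢p → Rich?-acc (rs (refl , d~e , e≢p))
    Cs : ℕ → Subset n
    Cs j = ⟦ C? j ⟧
    to : (∃ λ j → j < suc (suc k) × Nonempty (Cs j) × suc (suc k) ≤ ∣ Cs j ∣ ℕ.+ j) →
         Rich (suc k) p d
    to (j , _ , C≢∅ , le) = node (λ p∈ → proj₂ (proj₁ (∈⟦⟧⁻ (C? j) p∈)) refl)
      (fan j C≢∅ (λ e∈ → let ((d~e , _) , r) = ∈⟦⟧⁻ (C? j) e∈ in d~e , r) le)
    from : Rich (suc k) p d →
           ∃ λ j → j < suc (suc k) × Nonempty (Cs j) × suc (suc k) ≤ ∣ Cs j ∣ ℕ.+ j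
    from (node {C = C} p∉C (fan j C≢∅ f le)) with ℕ.≤-total j (suc k)
    ... | inj₁ j≤ = j , s≤s j≤ , (_ , C⊆ (proj₂ C≢∅)) ,
                    ℕ.≤-trans le (ℕ.+-monoˡ-≤ j (p⊆q⇒∣p∣≤∣q∣ C⊆))
      where
      C⊆ : C ⊆ Cs j
      C⊆ {e} e∈C =
        ∈⟦⟧⁺ (C? j) ((proj₁ (f e∈C) , λ { refl → p∉C e∈C }) , proj₂ (f e∈C))
    ... | inj₂ ≤j = suc k , ℕ.≤-refl , (_ , C⊆ (proj₂ C≢∅)) ,
                    ℕ.+-monoˡ-≤ (suc k) (Nonempty⇒1≤∣p∣ (_ , C⊆ (proj₂ C≢∅)))
      where
      C⊆ : C ⊆ Cs (suc k)
      C⊆ {e} e∈C = ∈⟦⟧⁺ (C? (suc k))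
        ((proj₁ (f e∈C) , λ { refl → p∉C e∈C }) , Rich-≤ ≤j (proj₂ (f e∈C)))

  Rich? : ∀ k p d → Dec (Rich k p d)
  Rich? k p d = Rich?-acc (≺-acc (p , d)) k

  -- Dominant children and pointed fans

  Dominant : ℕ → Fin n → Subset n → Fin n → Set
  Dominant k v C c = ∀ {e j} → e ∈ C → j ≤ k → Rich j v e → Rich j v c

  -- If some child has richness `suc k`, it dominates; otherwise richness `suc k` never occurs and
  -- the smaller range decides.
  dominant : ∀ k v {C} → Nonempty C → ∃ λ c → c ∈ C × Dominant k v C c
  dominant zero v (c , c∈C) = c , c∈C , λ { _ z≤n _ → leaf }
  dominant (suc k) v {C} C≢∅ with any? (λ e → (e ∈? C) ×-dec Rich? (suc k) v e)
  ... | yes (c , c∈C , r) = c , c∈C , λ _ j≤ _ → Rich-≤ j≤ r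
  ... | no none with dominant k v C≢∅
  ...   | c , c∈C , dom = c , c∈C , λ {e} {j} e∈C j≤ r → case ℕ.m≤n⇒m<n∨m≡n j≤ of λ
    { (inj₁ j<) → dom e∈C (ℕ.≤-pred j<) r
    ; (inj₂ refl) → ⊥-elim (none (e , e∈C , r)) }

  -- The root `v` itself may be filled.
  Clear : Subset n → Fin n → Subset n → Set
  Clear F v C = ∀ {e z} → e ∈ C → Branch v e z → z ∉ F

  Capped : ℕ → Subset n → Set
  Capped k F = ∀ {v C} → Fan (suc k) v C → ¬ Clear F v C

  Clear-singleton : ∀ {F v e} → (∀ {z} → Branch v e z → z ∉ F) → Clear F v ⁅ e ⁆
  Clear-singleton {e = e} clear e′∈ with x∈⁅y⁆⇒x≡y e e′∈
  ... | refl = clear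

  Clear-add : ∀ {F v C c} → Clear F v C → (∀ {z} → Branch v c z → z ∉ F) →
              Clear F v (C ∪ ⁅ c ⁆)
  Clear-add {C = C} clear clear′ e∈ with x∈p∪⁅y⁆⁻ {p = C} e∈
  ... | inj₁ e∈C = clear e∈C
  ... | inj₂ refl = clear′

  -- Seen from `v`, the vertices `p` and `x` lie in the same direction `c`. Either `c` is a child in
  -- the fan, or the whole fan faces away from `p`.
  off-branch : ∀ {k p d e v x C} → p ~ d → p ~ e → e ≢ d → Branch p e v → Branch p d x →
               Fan k v C → (∃ λ c → c ∈ C × Branch v c x) ⊎ (∀ {c} → c ∈ C → ¬ Branch v c p)
  off-branch {C = C} p~d p~e e≢d ev dx F
    with branch-of (Branch⇒∈V (~⇒∈V′ p~e) ev) (~⇒∈V p~e) (≢-sym (Branch⇒≢ p~e ev))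
  ... | c , v~c , cp with c ∈? C
  ...   | yes c∈C = inj₁ (c , c∈C , Branch-through v~c cp p~d dx
                                      λ dv → e≢d (Branch-unique p~e p~d ev dv))
  ...   | no c∉C = inj₂ λ c′∈C c′p →
    c∉C (subst (_∈ C) (Branch-unique (Fan⇒~ F c′∈C) v~c c′p cp) c′∈C)

  -- A token on such an `x` spoils every clear fan of value `k` at `v`.
  Points : Subset n → ℕ → Fin n → Fin n → Set
  Points F k v x = ∀ {C} → Fan k v C → Clear F v C → ∃ λ e → e ∈ C × Branch v e x

  -- If `p` were the only child, the fan would pass its full value on to a clear fan at `p` that
  -- does not use `d`.
  no-turning-back : ∀ {F k p d C} → p ~ d → (∀ {C} → Fan (suc k) p C → Clear F p C → d ∈ C) →
                    Fan (suc k) d C → Clear F d C → ∃ λ e → e ∈ C × e ≢ p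
  no-turning-back {p = p} {C = C} p~d uses-d G clear with any? (λ e → (e ∈? C) ×-dec ¬? (e ≟ p))
  ... | yes found = found
  ... | no none with Fan-within-singleton {e = p} G only-p
    where
    only-p : ∀ {e} → e ∈ C → e ≡ p
    only-p {e} e∈C with e ≟ p
    ... | yes e≡p = e≡p
    ... | no e≢p = ⊥-elim (none (e , e∈C , e≢p))
  ...   | p∈C , node d∉C′ G′ = ⊥-elim (d∉C′ (uses-d G′ λ {e} e∈C′ ez →
    clear p∈C (Branch-⊆ (~-sym p~d) (Fan⇒~ G′ e∈C′) (λ { refl → d∉C′ e∈C′ }) ez)))

  -- Following dominant children from p down to a leaf x: the invariant is that
  -- every clear fan of value k at the current vertex uses the next vertex.
  descend : ∀ {F k p d} → Acc _≺_ (p , d) → p ~ d → Capped (suc k) F →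
            (∀ {z} → Branch p d z → z ∉ F) →
            (∀ {C} → Fan (suc k) p C → Clear F p C → d ∈ C) →
            ∃ λ x → Branch p d x × (∀ {v} → v ≡ p ⊎ Branch p d v → Points F (suc k) v x)
  descend {F} {k} {p} {d} (acc rs) p~d capped clear-d uses-d
    with nonempty? ⟦ child? p d ⟧
  ... | no childless = d , ε , points
    where
    points : ∀ {v} → v ≡ p ⊎ Branch p d v → Points F (suc k) v d
    points (inj₁ refl) G clear = d , uses-d G clear , ε
    points {v} (inj₂ dv) G clear with v ≟ d
    ... | no v≢d = let e , d~e , e≢p , _ = Branch-descend p~d dv v≢d in
                   ⊥-elim (childless (e , ∈⟦⟧⁺ (child? p d) (d~e , e≢p)))
    ... | yes refl = let e , e∈C , e≢p = no-turning-back p~d uses-d G clear in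
                     ⊥-elim (childless (e , ∈⟦⟧⁺ (child? p d) (Fan⇒~ G e∈C , e≢p)))
  ... | yes children with dominant (suc k) d children
  ...   | c , c∈ , dom with ∈⟦⟧⁻ (child? p d) c∈
  ...     | d~c , c≢p with descend (rs (refl , d~c , c≢p)) d~c capped clear-c uses-c
    where
    clear-c : ∀ {z} → Branch d c z → z ∉ F
    clear-c cz = clear-d (Branch-⊆ p~d d~c c≢p cz)
    uses-c : ∀ {C} → Fan (suc k) d C → Clear F d C → c ∈ C
    uses-c {C} G clear with c ∈? C
    ... | yes c∈C = c∈C
    -- The child `e` differs from `p`, so `c` dominates it; adding `c` would give a clear fan above
    -- the cap.
    ... | no c∉C = let e , e∈C , e≢p = no-turning-back p~d uses-d G clear in
      ⊥-elim (capped
        (Fan-add G e∈C c∉C d~c (dom (∈⟦⟧⁺ (child? p d) (Fan⇒~ G e∈C , e≢p))))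
        (Clear-add {C = C} clear clear-c))
  ...       | x , cx , points-c = x , dx , points
    where
    dx : Branch p d x
    dx = Branch-⊆ p~d d~c c≢p cx
    points : ∀ {v} → v ≡ p ⊎ Branch p d v → Points F (suc k) v x
    points (inj₁ refl) G clear = d , uses-d G clear , dx
    points {v} (inj₂ dv) G clear with v ≟ d
    ... | yes refl = points-c (inj₁ refl) G clear
    ... | no v≢d with Branch-descend p~d dv v≢d
    ...   | e , d~e , e≢p , ev with e ≟ c
    ...     | yes refl = points-c (inj₂ ev) G clear
    -- A fan off the chosen direction that faces away from `d` lifts to a fan at `d` whose only
    -- child is `e`, which would then have to use `c`.
    ...     | no e≢c with off-branch d~c d~e e≢c ev cx G
    ...       | inj₁ found = found
    ...       | inj₂ away with points-c (inj₁ refl)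
                (Fan-singleton d~e (Rich-lift (≺-acc _) d~e ev G away))
                (Clear-singleton λ ez → clear-d (Branch-⊆ p~d d~e e≢p ez))
    ...         | e′ , e′∈ , e′x with x∈⁅y⁆⇒x≡y e e′∈
    ...           | refl = ⊥-elim (e≢c (Branch-unique d~e d~c e′x cx))

  -- The game

  -- This holds for every `p` on the empty board, and for a filled `p` that alone has unfilled
  -- neighbors.
  Stuck : Subset n → Fin n → Set
  Stuck F p = ∀ {e} → p ~ e →
    (∀ {z} → Branch p e z → z ∉ F) ⊎ (∀ {z} → Branch p e z → z ∈ F)

  unfilled-neighbor? : ∀ F u → Decidable₁ (λ y → u ~ y × y ∉ F)
  unfilled-neighbor? F u y = (u ~? y) ×-dec ¬? (y ∈? F)

  -- The walk starts towards a dominant unfilled neighbor of `p`. A clear fan at `p` that left it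
  -- out could be enlarged beyond the cap, which is the invariant that `descend` needs.
  best-token : ∀ {F k p d} → Capped (suc k) F → Stuck F p → p ~ d → d ∉ F →
               ∃ λ x → x ∈ V × x ∉ F × Capped k (F ∪ ⁅ x ⁆)
  best-token {F} {k} {p} capped stuck p~d₀ d₀∉F
    with dominant (suc k) p (_ , ∈⟦⟧⁺ (unfilled-neighbor? F p) (p~d₀ , d₀∉F))
  ... | d , d∈ , dom with ∈⟦⟧⁻ (unfilled-neighbor? F p) d∈
  ...   | p~d , d∉F with descend (≺-acc (p , d)) p~d capped clear-d uses-d
    where
    clear-d : ∀ {z} → Branch p d z → z ∉ F
    clear-d with stuck p~d
    ... | inj₁ clear = clear
    ... | inj₂ full = ⊥-elim (d∉F (full ε))
    uses-d : ∀ {C} → Fan (suc k) p C → Clear F p C → d ∈ C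
    uses-d {C} G@(fan _ (e , e∈C) _ _) clear with d ∈? C
    ... | yes d∈C = d∈C
    ... | no d∉C = ⊥-elim (capped
      (Fan-add G e∈C d∉C p~d (dom (∈⟦⟧⁺ (unfilled-neighbor? F p) (Fan⇒~ G e∈C , clear e∈C ε))))
      (Clear-add {C = C} clear clear-d))
  ...     | x , dx , points = x , Branch⇒∈V (~⇒∈V′ p~d) dx , x∉F , capped′
    where
    x∉F : x ∉ F
    x∉F with stuck p~d
    ... | inj₁ clear = clear dx
    ... | inj₂ full = ⊥-elim (d∉F (full ε))
    capped′ : Capped k (F ∪ ⁅ x ⁆)
    capped′ {v} {C} G@(fan _ (e₀ , e₀∈C) _ _) clear′ = case v ≟ p of λ
      { (yes v≡p) → pointed (points (inj₁ v≡p) G clear)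
      ; (no v≢p) → beyond v≢p }
      where
      clear : Clear F v C
      clear e∈C ez z∈F = clear′ e∈C ez (p⊆p∪q ⁅ x ⁆ z∈F)
      pointed : ¬ ∃ λ e → e ∈ C × Branch v e x
      pointed (e , e∈C , ex) = clear′ e∈C ex (x∈p∪⁅x⁆ {p = F})
      beyond : ¬ v ≢ p
      beyond v≢p
        with branch-of (~⇒∈V p~d) (~⇒∈V (Fan⇒~ G e₀∈C)) v≢p
      ... | e , p~e , ev with e ≟ d
      ...   | yes refl = pointed (points (inj₂ ev) G clear)
      ...   | no e≢d with off-branch p~d p~e e≢d ev dx G | stuck p~e
      ...     | inj₁ found | _ = pointed found
      ...     | inj₂ away | inj₁ clear-e with points (inj₁ refl)
                  (Fan-singleton p~e (Rich-lift (≺-acc _) p~e ev G away))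
                  (Clear-singleton clear-e)
      ...       | e′ , e′∈ , e′x with x∈⁅y⁆⇒x≡y e e′∈
      ...         | refl = e≢d (Branch-unique p~e p~d e′x dx)
      -- The fan faces away from `p`, so its child `e₀` lies in the filled branch of `e`, although
      -- it is clear.
      beyond v≢p | e , p~e , ev | no e≢d | inj₂ away | inj₂ full-e =
        clear e₀∈C ε (full-e (Branch-step p~e ev (Fan⇒~ G e₀∈C) λ { refl → away e₀∈C ε }))

  -- The player's strategy

  boundary-edge : ∀ {F f z} → Star _~_ f z → f ∈ F → z ∉ F →
                  ∃₂ λ u y → u ∈ F × u ~ y × y ∉ F
  boundary-edge ε f∈F f∉F = ⊥-elim (f∉F f∈F)
  boundary-edge {F} (_◅_ {i = u} {j = y} u~y st) u∈F z∉F with y ∈? F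
  ... | yes y∈F = boundary-edge st y∈F z∉F
  ... | no y∉F = u , y , u∈F , u~y , y∉F

  component⊆Branch : ∀ {F U u y x} → IsComponent (T [ ∁ F ]) U → u ∈ F → y ∈ U → x ∈ U →
                     Branch u y x
  component⊆Branch comp u∈F y∈U x∈U = Star-map
    (λ (_ , _ , a∈∁F , b∈∁F , a~b) → a~b , (λ { refl → x∈∁p⇒x∉p a∈∁F u∈F })
                                        , (λ { refl → x∈∁p⇒x∉p b∈∁F u∈F }))
    (component-walk (T [ ∁ _ ]) comp y∈U x∈U)

  Sole : Subset n → Fin n → Fin n → Set
  Sole F u y = u ~ y × y ∉ F × (∀ x → u ~ x → x ∉ F → x ≡ y)

  -- If every unfilled neighbor of `u` lies in the branch towards `u′`, there is only one, and `u`
  -- can force it.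
  away-or-sole : ∀ {F u u′ y} → u ~ y → y ∉ F →
    (∃ λ y → u ~ y × y ∉ F × ¬ Branch u y u′) ⊎ ∃ (Sole F u)
  away-or-sole {F} {u} {u′} {y} u~y y∉F with any? away?
    where
    away? : Decidable₁ (λ y → u ~ y × y ∉ F × ¬ Branch u y u′)
    away? y with u ~? y | y ∈? F
    ... | no u≁y | _ = no (u≁y ∘ proj₁)
    ... | yes _ | yes y∈F = no λ (_ , y∉F , _) → y∉F y∈F
    ... | yes u~y | no y∉F = map′ (λ ¬b → u~y , y∉F , ¬b) (proj₂ ∘ proj₂) (¬? (Branch? u~y u′))
  ... | yes found = inj₁ found
  ... | no none = inj₂ (y , u~y , y∉F , λ x u~x x∉F →
    Branch-unique u~x u~y (toward u~x x∉F) (toward u~y y∉F))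
    where
    toward : ∀ {x} → u ~ x → x ∉ F → Branch u x u′
    toward {x} u~x x∉F with Branch? u~x u′
    ... | yes b = b
    ... | no ¬b = ⊥-elim (none (x , u~x , x∉F , ¬b))

  -- U′ lies in a branch of T - u′ without u, so no vertex of U′ is next to u:
  -- u can force y if the oracle returns U, with or without U′.
  response : ∀ {F Rs u y U u′ y′ U′} → u ∈ F → u ~ y → y ∉ F → y ∈ U →
             IsComponent (T [ ∁ F ]) U →
             u′ ∈ F → u′ ~ y′ → y′ ∈ U′ → IsComponent (T [ ∁ F ]) U′ →
             u′ ≢ u → ¬ Branch u′ y′ u →
             (∀ {R} → R ∈ˡ Rs → R ≡ U ⊎ R ≡ U′) → U ∈ˡ Rs →
             (T [ F ∪ ⋃ Rs ]) ⊢ F ⟶ (F ∪ ⁅ y ⁆)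
  response {F} {Rs} {u} {y} {U} {u′} {y′} u∈F u~y y∉F y∈U comp u′∈F u′~y′ y′∈U′ comp′ u′≢u ¬b
           Rs⊆ U∈Rs =
    fill u y u∈F y∉F
      (p⊆p∪q (⋃ Rs) u∈F , q⊆p∪q F (⋃ Rs) (x∈⋃⁺ U∈Rs y∈U) , u~y) only
    where
    only : ∀ x → (T [ F ∪ ⋃ Rs ]) ∋ u ~ x → x ∉ F → x ≡ y
    only x (_ , x∈ , u~x) x∉F with x∈p∪q⁻ F (⋃ Rs) x∈
    ... | inj₁ x∈F = ⊥-elim (x∉F x∈F)
    ... | inj₂ x∈Rs with x∈⋃⁻ Rs x∈Rs
    ...   | R , R∈Rs , x∈R with Rs⊆ R∈Rs
    ...     | inj₁ refl =
      sym (neighbors-joined⇒≡ u~y u~x (component⊆Branch comp u∈F y∈U x∈R))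
    ...     | inj₂ refl = ⊥-elim (¬b (Branch-step u′~y′
      (component⊆Branch comp′ u′∈F y′∈U′ x∈R) (~-sym u~x) (≢-sym u′≢u)))

  Capped-⊆ : ∀ {k F F′} → F ⊆ F′ → Capped k F → Capped k F′
  Capped-⊆ F⊆F′ capped G clear = capped G λ e∈C ez z∈F → clear e∈C ez (F⊆F′ z∈F)

  Active : Subset n → Fin n → Set
  Active F u = u ∈ F × ∃ λ y → u ~ y × y ∉ F

  active? : ∀ F → Decidable₁ (Active F)
  active? F u = (u ∈? F) ×-dec any? (unfilled-neighbor? F u)

  -- A branch at `u` with both filled and unfilled vertices contains an edge between them, and its
  -- filled end is a second active vertex.
  sole-active⇒Stuck : ∀ {F u} → (¬ ∃ λ u′ → u′ ≢ u × Active F u′) → Stuck F u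
  sole-active⇒Stuck {F} {u} none {e} u~e with e ∈? F
  ... | yes e∈F = inj₂ (filled e∈F)
    where
    filled : ∀ {x z} → x ∈ F → Star (Avoiding u) x z → z ∈ F
    filled x∈F ε = x∈F
    filled {x} x∈F (_◅_ {j = y} (x~y , x≢u , _) st) with y ∈? F
    ... | yes y∈F = filled y∈F st
    ... | no y∉F = ⊥-elim (none (x , x≢u , x∈F , y , x~y , y∉F))
  ... | no e∉F = inj₁ (unfilled e∉F)
    where
    unfilled : ∀ {x z} → x ∉ F → Star (Avoiding u) x z → z ∉ F
    unfilled x∉F ε = x∉F
    unfilled {x} x∉F (_◅_ {j = y} (x~y , _ , y≢u) st) with y ∈? F
    ... | no y∉F = unfilled y∉F st
    ... | yes y∈F = λ _ → none (y , y≢u , y∈F , x , ~-sym x~y , x∉F)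

  Fan-pair : ∀ {u y y′} → u ~ y → u ~ y′ → y′ ≢ y → Fan 1 u (⁅ y ⁆ ∪ ⁅ y′ ⁆)
  Fan-pair {y = y} u~y u~y′ y′≢y = Fan-add (Fan-singleton u~y leaf)
    (x∈⁅x⁆ y) (y′≢y ∘ x∈⁅y⁆⇒x≡y y) u~y′ λ { z≤n _ → leaf }

  stuck⇒¬Capped-0 : ∀ {F u y y′} → Stuck F u → u ~ y → y ∉ F → u ~ y′ → y′ ∉ F → y′ ≢ y →
                    ¬ Capped 0 F
  stuck⇒¬Capped-0 {F} {u} {y} {y′} stuck u~y y∉F u~y′ y′∉F y′≢y capped =
    capped (Fan-pair u~y u~y′ y′≢y)
      (Clear-add {C = ⁅ y ⁆} (Clear-singleton (clear u~y y∉F)) (clear u~y′ y′∉F))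
    where
    clear : ∀ {e} → u ~ e → e ∉ F → ∀ {z} → Branch u e z → z ∉ F
    clear u~e e∉F with stuck u~e
    ... | inj₁ clear-e = clear-e
    ... | inj₂ full-e = ⊥-elim (e∉F (full-e ε))

  unfilled-vertex : ∀ F → (∃ λ z → z ∈ V × z ∉ F) ⊎ V ⊆ F
  unfilled-vertex F with any? (λ z → (z ∈? V) ×-dec ¬? (z ∈? F))
  ... | yes found = inj₁ found
  ... | no none = inj₂ λ {z} z∈V → case z ∈? F of λ
    { (yes z∈F) → z∈F ; (no z∉F) → ⊥-elim (none (z , z∈V , z∉F)) }

  -- Every move fills a vertex, so `m` decreases. The filled vertex `f` provides an edge from filled
  -- to unfilled; on the empty board there is none.
  capped⇒Wins : ∀ m {k F f} → ∣ ∁ F ∣ ≤ m → f ∈ V → f ∈ F → Capped k F → Wins 1 T k F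
  capped⇒Wins m {F = F} _ f∈V f∈F _ with unfilled-vertex F
  ... | inj₂ V⊆F = done V⊆F
  capped⇒Wins zero ∣∁F∣≤ _ _ _ | inj₁ (z , _ , z∉F) =
    ⊥-elim (ℕ.<⇒≱ (Nonempty⇒1≤∣p∣ (z , x∉p⇒x∈∁p z∉F)) ∣∁F∣≤)
  capped⇒Wins (suc m) {k} {F} ∣∁F∣≤ f∈V f∈F capped | inj₁ (z , z∈V , z∉F)
    with boundary-edge (connected f∈V z∈V) f∈F z∉F
  ... | u , y , u∈F , u~y , y∉F = go
    where
    continue : ∀ {k x} → x ∉ F → Capped k (F ∪ ⁅ x ⁆) → Wins 1 T k (F ∪ ⁅ x ⁆)
    continue {x = x} x∉F = capped⇒Wins m
      (ℕ.≤-pred (ℕ.≤-trans (∣∁[p∪⁅x⁆]∣<∣∁p∣ x∉F) ∣∁F∣≤)) f∈V (p⊆p∪q ⁅ x ⁆ f∈F)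
    advance : ∀ {x} → x ∉ F → Wins 1 T k (F ∪ ⁅ x ⁆)
    advance {x} x∉F = continue x∉F (Capped-⊆ (p⊆p∪q ⁅ x ⁆) capped)
    force-sole : ∀ {u} → u ∈ F → ∃ (Sole F u) → Wins 1 T k F
    force-sole {u} u∈F (x , u~x , x∉F , only) =
      force (fill u x u∈F x∉F u~x only) (advance x∉F)

    spend : ∀ {k} → Capped k F → Stuck F u → ∀ {y′} → u ~ y′ → y′ ∉ F → y′ ≢ y → Wins 1 T k F
    -- Two unfilled branches at `u` form a clear fan of value 1, so a token is never wanted when
    -- none is left.
    spend {zero} capped stuck u~y′ y′∉F y′≢y =
      ⊥-elim (stuck⇒¬Capped-0 stuck u~y y∉F u~y′ y′∉F y′≢y capped)
    spend {suc k} capped stuck _ _ _ =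
      let x , x∈V , x∉F , capped′ = best-token capped stuck u~y y∉F
      in token x x∈V x∉F (continue x∉F capped′)

    announce : ∀ {u y u′ y′} → u ∈ F → u ~ y → y ∉ F → ¬ Branch u y u′ →
               u′ ∈ F → u′ ~ y′ → y′ ∉ F → ¬ Branch u′ y′ u → u′ ≢ u → Wins 1 T k F
    announce {u} {y} {u′} {y′} u∈F u~y y∉F ¬b u′∈F u′~y′ y′∉F ¬b′ u′≢u
      with component-of (T [ ∁ F ]) (x∈p∩q⁺ (~⇒∈V′ u~y , x∉p⇒x∈∁p y∉F))
         | component-of (T [ ∁ F ]) (x∈p∩q⁺ (~⇒∈V′ u′~y′ , x∉p⇒x∈∁p y′∉F))
    ... | U , comp , y∈U | U′ , comp′ , y′∈U′ =
      oracle (U ∷ U′ ∷ []) (comp ∷ comp′ ∷ []) ((U≢U′ ∷ []) ∷ [] ∷ []) (s≤s (s≤s z≤n)) answer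
      where
      U≢U′ : U ≢ U′
      -- If `y` and `y′` shared a component, `u′` would lie in the branch of `y` at `u`.
      U≢U′ refl = ¬b (Branch-step u~y (component⊆Branch comp u∈F y∈U y′∈U′)
                                  (~-sym u′~y′) u′≢u)
      either : ∀ {R} → R ∈ˡ U ∷ U′ ∷ [] → R ≡ U ⊎ R ≡ U′
      either (here R≡U) = inj₁ R≡U
      either (there (here R≡U′)) = inj₂ R≡U′
      swap : ∀ {R} → R ≡ U ⊎ R ≡ U′ → R ≡ U′ ⊎ R ≡ U
      swap (inj₁ R≡U) = inj₂ R≡U
      swap (inj₂ R≡U′) = inj₁ R≡U′
      answer : ∀ Rs → Rs Sublist.⊆ U ∷ U′ ∷ [] → Rs ≢ [] →
               ∃ λ F′ → Star ((T [ F ∪ ⋃ Rs ]) ⊢_⟶_) F F′ × Wins 1 T k F′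
      answer [] _ Rs≢[] = ⊥-elim (Rs≢[] refl)
      -- The first returned component decides which of `u` and `u′` forces; the other component does
      -- not block it.
      answer (R ∷ Rs) Rs⊆ _ with either (Sublist.lookup Rs⊆ (here refl))
      ... | inj₁ refl = _ ,
        response u∈F u~y y∉F y∈U comp u′∈F u′~y′ y′∈U′ comp′ u′≢u ¬b′
                 (either ∘ Sublist.lookup Rs⊆) (here refl) ◅ ε ,
        advance y∉F
      ... | inj₂ refl = _ ,
        response u′∈F u′~y′ y′∉F y′∈U′ comp′ u∈F u~y y∈U comp (≢-sym u′≢u) ¬b
                 (swap ∘ either ∘ Sublist.lookup Rs⊆) (here refl) ◅ ε ,
        advance y′∉F

    go : Wins 1 T k F
    go with any? (λ u′ → ¬? (u′ ≟ u) ×-dec active? F u′)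
    ... | yes (u′ , u′≢u , u′∈F , y′ , u′~y′ , y′∉F)
      with away-or-sole {u′ = u′} u~y y∉F | away-or-sole {u′ = u} u′~y′ y′∉F
    ...   | inj₂ sole | _ = force-sole u∈F sole
    ...   | inj₁ _ | inj₂ sole = force-sole u′∈F sole
    ...   | inj₁ (_ , u~x , x∉F , ¬b) | inj₁ (_ , u′~x′ , x′∉F , ¬b′) =
      announce u∈F u~x x∉F ¬b u′∈F u′~x′ x′∉F ¬b′ u′≢u
    go | no none with any? (λ y′ → ¬? (y′ ≟ y) ×-dec unfilled-neighbor? F u y′)
    ... | yes (y′ , y′≢y , u~y′ , y′∉F) = spend capped (sole-active⇒Stuck none) u~y′ y′∉F y′≢y
    ... | no only = force-sole u∈F (y , u~y , y∉F , λ x u~x x∉F → case x ≟ y of λ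
      { (yes x≡y) → x≡y ; (no x≢y) → ⊥-elim (only (x , x≢y , u~x , x∉F)) })

  -- The oracle's strategy

  branch-containing? : ∀ {m v C} → Fan m v C → ∀ y → Dec (∃ λ e → e ∈ C × Branch v e y)
  branch-containing? {v = v} {C} G y = any? dec
    where
    dec : Decidable₁ (λ e → e ∈ C × Branch v e y)
    dec e with e ∈? C
    ... | no e∉C = no (e∉C ∘ proj₁)
    ... | yes e∈C = map′ (e∈C ,_) proj₂ (Branch? (Fan⇒~ G e∈C) y)

  Clear-extend : ∀ {F v C y} → Clear F v C → (∀ {e} → e ∈ C → ¬ Branch v e y) →
                 Clear (F ∪ ⁅ y ⁆) v C
  Clear-extend {F} clear ¬y e∈C ez z∈ with x∈p∪⁅y⁆⁻ {p = F} z∈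
  ... | inj₁ z∈F = clear e∈C ez z∈F
  ... | inj₂ refl = ¬y e∈C ez

  Clear-child : ∀ {F v C e m C′} → Clear F v C → e ∈ C → v ~ e → v ∉ C′ → Fan m e C′ →
                Clear F e C′
  Clear-child clear e∈C v~e v∉C′ G e′∈C′ e′z =
    clear e∈C (Branch-⊆ v~e (Fan⇒~ G e′∈C′) (λ { refl → v∉C′ e′∈C′ }) e′z)

  Bounds : ℕ → Subset n → Set
  Bounds k F = ∀ {m v C} → Fan m v C → Clear F v C → m ≤ k

  Bounds-token : ∀ {F k y} → Bounds k (F ∪ ⁅ y ⁆) → Bounds (suc k) F
  Bounds-token {F} {k} {y} bound {m} {v} {C} G@(fan j C≢∅ f le) clear
    with branch-containing? G y
  ... | no none = ℕ.m≤n⇒m≤1+n (bound G (Clear-extend clear λ e∈C ey → none (_ , e∈C , ey)))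
  ... | yes (e , e∈C , ey) with any? (λ e′ → (e′ ∈? C) ×-dec ¬? (e′ ≟ e))
  ...   | yes (e′ , e′∈C , e′≢e) = prune m le
    where
    prune : ∀ m → suc m ≤ ∣ C ∣ ℕ.+ j → m ≤ suc k
    prune zero _ = z≤n
    -- The child `e′` keeps the pruned set nonempty, and losing `e` costs one unit of value.
    prune (suc m) le = s≤s (bound
      (fan j (e′ , x∈p∧x≢y⇒x∈p-y e′∈C e′≢e) (f ∘ p─q⊆p C ⁅ e ⁆)
           (ℕ.≤-pred (ℕ.≤-trans le (ℕ.+-monoˡ-≤ j (∣p∣≤1+∣p-x∣ C e)))))
      (Clear-extend (clear ∘ p─q⊆p C ⁅ e ⁆) λ {e″} e″∈ e″y → x∈p-y⇒x≢y {p = C} e″∈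
        (Branch-unique (Fan⇒~ G (p─q⊆p C ⁅ e ⁆ e″∈)) (Fan⇒~ G e∈C) e″y ey)))
  ...   | no none = ℕ.≤-trans
    (ℕ.≤-pred (ℕ.≤-trans le (ℕ.+-monoˡ-≤ j (p⊆⁅x⁆⇒∣p∣≤1 only-e)))) (reroot (f e∈C))
    where
    only-e : ∀ {e′} → e′ ∈ C → e′ ≡ e
    only-e {e′} e′∈C with e′ ≟ e
    ... | yes e′≡e = e′≡e
    ... | no e′≢e = ⊥-elim (none (e′ , e′∈C , e′≢e))
    reroot : v ~ e × Rich j v e → j ≤ suc k
    reroot (_ , leaf) = z≤n
    reroot (v~e , node v∉C′ G′) =
      Bounds-token bound G′ (Clear-child clear e∈C v~e v∉C′ G′)

  -- A filled neighbor of `w` other than `v` would lie in the same branch as `w`, which is clear.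
  filling-at-root : ∀ {F v C u w e m} → Fan m v C → Clear F v C → e ∈ C → Branch v e w →
                    u ∈ F → u ~ w → u ≡ v × e ≡ w
  filling-at-root {v = v} {u = u} G clear e∈C ew u∈F u~w with u ≟ v
  ... | yes refl = refl , neighbors-joined⇒≡ (Fan⇒~ G e∈C) u~w ew
  ... | no u≢v = ⊥-elim (clear e∈C (Branch-step (Fan⇒~ G e∈C) ew (~-sym u~w) u≢v) u∈F)

  -- A force into a child branch comes from `v` and fills its only child. Moving the root to that
  -- child keeps the value, and a filled root does not affect clearness.
  Bounds-force : ∀ {F F′ k} → T ⊢ F ⟶ F′ → Bounds k F′ → Bounds k F
  Bounds-force {F} {k = k} (fill u w u∈F w∉F u~w only) bound {m} {v} {C} G clear
    with branch-containing? G w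
  ... | no none = bound G (Clear-extend clear λ e∈C ew → none (_ , e∈C , ew))
  ... | yes (e , e∈C , ew) with filling-at-root G clear e∈C ew u∈F u~w
  ...   | refl , refl = reroot (Fan-within-singleton G λ {e′} e′∈C →
                                  only e′ (Fan⇒~ G e′∈C) (clear e′∈C ε))
    where
    reroot : e ∈ C × Rich m v e → m ≤ k
    reroot (_ , leaf) = z≤n
    reroot (_ , node v∉C′ G′) = bound G′
      (Clear-extend (Clear-child clear e∈C u~w v∉C′ G′)
                    λ e′∈C′ e′e → Branch⇒≢ (Fan⇒~ G′ e′∈C′) e′e refl)

  filled⊆ : ∀ {X F F′} → Star ((T [ X ]) ⊢_⟶_) F F′ → ∀ {z} → z ∈ F′ → z ∈ F ⊎ z ∈ X
  filled⊆ ε z∈F = inj₁ z∈F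
  filled⊆ {F = F} (fill u w _ _ (_ , w∈X , _) _ ◅ st) z∈F′ with filled⊆ st z∈F′
  ... | inj₂ z∈X = inj₂ z∈X
  ... | inj₁ z∈F∪w with x∈p∪⁅y⁆⁻ {p = F} z∈F∪w
  ...   | inj₁ z∈F = inj₁ z∈F
  ...   | inj₂ refl = inj₂ w∈X

  clear-branch-walk : ∀ {F v e z} → v ~ e → (∀ {x} → Branch v e x → x ∉ F) → Branch v e z →
                      Star (Graph._~_ (T [ ∁ F ])) e z
  clear-branch-walk {F} {v} {e} v~e clear = go ε
    where
    go : ∀ {x z} → Branch v e x → Star (Avoiding v) x z → Star (Graph._~_ (T [ ∁ F ])) x z
    go ex ε = ε
    go {x} ex (_◅_ {j = y} (x~y , _ , y≢v) st) =
      (x∉p⇒x∈∁p (clear ex) , x∉p⇒x∈∁p (clear ey) , x~y) ◅ go ey st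
      where
      ey : Branch v e y
      ey = Branch-step v~e ex x~y y≢v

  -- A newly filled vertex lies in `U`. Were it in a child branch, the unfilled walk back to the
  -- child would put the child in `U` too.
  Clear-after : ∀ {F F′ U v C m} → Fan m v C → Clear F v C → IsComponent (T [ ∁ F ]) U →
                ¬ Nonempty (C ∩ U) → Star ((T [ F ∪ ⋃ (U ∷ []) ]) ⊢_⟶_) F F′ → Clear F′ v C
  Clear-after {F} {U = U} G clear comp disjoint st {e} e∈C ez z∈F′ with filled⊆ st z∈F′
  ... | inj₁ z∈F = clear e∈C ez z∈F
  ... | inj₂ z∈X with x∈p∪q⁻ F (⋃ (U ∷ [])) z∈X
  ...   | inj₁ z∈F = clear e∈C ez z∈F
  ...   | inj₂ z∈U with x∈⋃⁻ (U ∷ []) z∈U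
  ...     | _ , here refl , z∈U = disjoint (e , x∈p∩q⁺ (e∈C ,
    component-closed* (T [ ∁ F ]) comp z∈U (reverse (Graph.~-sym (T [ ∁ F ]))
      (clear-branch-walk (Fan⇒~ G e∈C) (clear e∈C) ez))))

  -- An unfilled `v` would join the two components, so `v` is filled. Then every force into them
  -- must come from `v`, which sees an unfilled child in each.
  two-children-block : ∀ {F F′ U U′ v C m} → Fan m v C → Clear F v C →
    IsComponent (T [ ∁ F ]) U → IsComponent (T [ ∁ F ]) U′ → U ≢ U′ →
    Nonempty (C ∩ U) → Nonempty (C ∩ U′) → ¬ ((T [ F ∪ ⋃ (U ∷ U′ ∷ []) ]) ⊢ F ⟶ F′)
  two-children-block {F} {U = U} {U′} {v} {C} G clear comp comp′ U≢U′ (e , e∈) (e′ , e′∈)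
    (fill u w u∈F w∉F (u∈X , w∈X , u~w) only)
    with x∈p∩q⁻ C U e∈ | x∈p∩q⁻ C U′ e′∈
  ... | e∈C , e∈U | e′∈C , e′∈U′ = distinct λ x∈U x∈U′ → U≢U′ (⊆-antisym
          (components-meeting⇒⊆ (T [ ∁ F ]) comp comp′ x∈U x∈U′)
          (components-meeting⇒⊆ (T [ ∁ F ]) comp′ comp x∈U′ x∈U))
    where
    v∈F⊎v∈ : ∀ {e U} → e ∈ C → e ∈ U → IsComponent (T [ ∁ F ]) U → v ∉ F → v ∈ U
    v∈F⊎v∈ e∈C e∈U comp v∉F = component-closed (T [ ∁ F ]) comp e∈U
      (x∉p⇒x∈∁p (clear e∈C ε) , x∉p⇒x∈∁p v∉F , ~-sym (Fan⇒~ G e∈C))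
    into : ∀ {R} → R ∈ˡ U ∷ U′ ∷ [] → R ⊆ F ∪ ⋃ (U ∷ U′ ∷ [])
    into R∈ x∈R = q⊆p∪q F _ (x∈⋃⁺ R∈ x∈R)
    u≡v-in : ∀ {e R} → v ∈ F → e ∈ C → e ∈ R → IsComponent (T [ ∁ F ]) R → w ∈ R → u ≡ v
    u≡v-in v∈F e∈C e∈R comp w∈R = proj₁ (filling-at-root G clear e∈C
      (component⊆Branch comp v∈F e∈R w∈R) u∈F u~w)
    u≡v : v ∈ F → u ≡ v
    u≡v v∈F with x∈p∪q⁻ F _ w∈X
    ... | inj₁ w∈F = ⊥-elim (w∉F w∈F)
    ... | inj₂ w∈Rs with x∈⋃⁻ (U ∷ U′ ∷ []) w∈Rs
    ...   | _ , here refl , w∈U = u≡v-in v∈F e∈C e∈U comp w∈U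
    ...   | _ , there (here refl) , w∈U′ = u≡v-in v∈F e′∈C e′∈U′ comp′ w∈U′
    distinct : ¬ (∀ {x} → x ∈ U → ¬ x ∈ U′)
    distinct disjoint with v ∈? F
    ... | no v∉F = disjoint (v∈F⊎v∈ e∈C e∈U comp v∉F) (v∈F⊎v∈ e′∈C e′∈U′ comp′ v∉F)
    ... | yes v∈F with u≡v v∈F
    ...   | refl = disjoint (subst (_∈ U) (trans (only-e e∈C (here refl) e∈U)
                             (sym (only-e e′∈C (there (here refl)) e′∈U′))) e∈U) e′∈U′
      where
      only-e : ∀ {e R} → e ∈ C → R ∈ˡ U ∷ U′ ∷ [] → e ∈ R → e ≡ w
      only-e e∈C R∈ e∈R = only _ (u∈X , into R∈ e∈R , Fan⇒~ G e∈C) (clear e∈C ε)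

  Wins⇒Bounds : ∀ {k F} → Wins 1 T k F → Bounds k F
  Wins⇒Bounds (done V⊆F) G@(fan _ (e , e∈C) _ _) clear =
    ⊥-elim (clear e∈C ε (V⊆F (~⇒∈V′ (Fan⇒~ G e∈C))))
  Wins⇒Bounds (token y _ _ W) = Bounds-token (Wins⇒Bounds W)
  Wins⇒Bounds (force st W) = Bounds-force st (Wins⇒Bounds W)
  Wins⇒Bounds (oracle (U ∷ []) _ _ (s≤s ()) _)
  Wins⇒Bounds {F = F} (oracle (U ∷ U′ ∷ Us) (comp ∷ comp′ ∷ _) ((U≢U′ ∷ _) ∷ _) _ answer)
    {C = C} G clear with nonempty? (C ∩ U) | nonempty? (C ∩ U′)
  ... | no disjoint | _
    with answer (U ∷ []) (refl ∷ Sublist.minimum (U′ ∷ Us)) (λ ())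
  ...   | _ , st , W = Wins⇒Bounds W G (Clear-after G clear comp disjoint st)
  Wins⇒Bounds {F = F} (oracle (U ∷ U′ ∷ Us) (comp ∷ comp′ ∷ _) ((U≢U′ ∷ _) ∷ _) _ answer)
    {C = C} G clear | yes meets | no disjoint
    with answer (U′ ∷ []) (U Sublist.∷ʳ (refl ∷ Sublist.minimum Us)) (λ ())
  ...   | _ , st , W = Wins⇒Bounds W G (Clear-after G clear comp′ disjoint st)
  Wins⇒Bounds {F = F} (oracle (U ∷ U′ ∷ Us) (comp ∷ comp′ ∷ _) ((U≢U′ ∷ _) ∷ _) _ answer)
    {C = C} G clear | yes meets | yes meets′
    with answer (U ∷ U′ ∷ []) (refl ∷ refl ∷ Sublist.minimum Us) (λ ())
  -- The player made no force after the answer, so the position and the fan are unchanged.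
  ...   | _ , ε , W = Wins⇒Bounds W G clear
  ...   | _ , st ◅ _ , _ =
    ⊥-elim (two-children-block G clear comp comp′ U≢U′ meets meets′ st)

  -- Path weights in a subtree

  module Subtree (S : Graph n) (S⊑T : S ⊑ T) where

    private
      module S = Graph S

    Trail⇒Branch : ∀ {p w P} → p ~ w → Trail S p w P → All (Branch p w) P
    Trail⇒Branch _ end = ε ∷ []
    Trail⇒Branch p~w (next w~e e≢p t) =
      ε ∷ All.map (Branch-⊆ p~w (proj₂ S⊑T w~e) e≢p) (Trail⇒Branch (proj₂ S⊑T w~e) t)

    -- After leaving `w` the trail stays in one branch at `w`, which does not contain `w`.
    Trail⇒Unique : ∀ {p w P} → Trail S p w P → Unique P
    Trail⇒Unique end = [] ∷ []
    Trail⇒Unique (next w~e _ t) =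
      All.map (λ ez → ≢-sym (Branch⇒≢ (proj₂ S⊑T w~e) ez)) (Trail⇒Branch (proj₂ S⊑T w~e) t)
        ∷ Trail⇒Unique t

    Trail⇒PathFrom : ∀ {v P} → v ∈ S.V → Trail S v v P → PathFrom S v P
    Trail⇒PathFrom v∈ t =
      (nonempty t , Trail⇒∈V S v∈ t , Trail⇒Linked S t , Trail⇒Unique t) , starts t
      where
      nonempty : ∀ {v P} → Trail S v v P → P ≢ []
      nonempty end ()
      nonempty (next _ _ _) ()
      starts : ∀ {v P} → Trail S v v P → ∃ λ vs → P ≡ v ∷ vs
      starts end = _ , refl
      starts (next _ _ _) = _ , refl

    PathFrom⇒Trail : ∀ {v P} → PathFrom S v P → Trail S v v P
    PathFrom⇒Trail ((_ , _ , l , u@(v∉ ∷ _)) , _ , refl) = path⇒Trail S l u v∉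

    Down⇒Maximal : ∀ {v P c} → v ∈ S.V → Down S v v P c → MaximalPathFrom S v P
    Down⇒Maximal v∈ D = Trail⇒PathFrom v∈ (Down⇒Trail S D) ,
      λ (Q , path , pre , lt) → Down-not-extendable S D (PathFrom⇒Trail path) pre lt

    Maximal⇒Down : ∀ {v P} → v ∈ S.V → MaximalPathFrom S v P → ∃ (Down S v v P)
    Maximal⇒Down v∈ (path , maximal) = unextendable⇒Down S (PathFrom⇒Trail path)
      λ t pre lt → maximal (_ , Trail⇒PathFrom v∈ t , pre , lt)

    Down⇒weight+2 : ∀ {v P c} → Down S v v P c → weight S P + + 2 ≡ + c
    Down⇒weight+2 D = trans (Down⇒weight S (deg-root S) D) (cong +_ (ℕ.+-identityʳ _))

    -- Having `b + 1` children contributes `b` to the cost, so each child is tested against the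
    -- threshold lowered by `b`. One cheap child yields a cheap path; if none is cheap, the children
    -- form a fan.
    cheap-Down⊎Rich : ∀ {p w} → Acc _≺_ (p , w) → ∀ k →
                      (∃₂ λ P c → Down S p w P c × c < k) ⊎ Rich k p w
    cheap-Down⊎Rich _ zero = inj₂ leaf
    cheap-Down⊎Rich {p} {w} (acc rs) (suc k) with nonempty? (children S p w)
    ... | no childless = inj₁ (_ , 0 , stop only-p , s≤s z≤n)
      where
      only-p : ∀ {e} → w S.~ e → e ≡ p
      only-p {e} w~e with e ≟ p
      ... | yes e≡p = e≡p
      ... | no e≢p = ⊥-elim (childless (e , ∈children⁺ S w~e e≢p))
    ... | yes C≢∅ with ⊎-search via
      where
      b : ℕ
      -- If `b` exceeds `suc k`, the threshold is truncated to 0: no path is below it, and every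
      -- branch is rich to degree 0.
      b = ℕ.pred ∣ children S p w ∣
      via : ∀ e → (e ∈ children S p w × ∃₂ λ P c → Down S w e P c × c < suc k ℕ.∸ b) ⊎
                  (e ∈ children S p w → Rich (suc k ℕ.∸ b) w e)
      via e with e ∈? children S p w
      ... | no e∉ = inj₂ λ e∈ → ⊥-elim (e∉ e∈)
      ... | yes e∈ with ∈children⁻ S {p} e∈
      ...   | w~e , e≢p with cheap-Down⊎Rich (rs (refl , proj₂ S⊑T w~e , e≢p)) (suc k ℕ.∸ b)
      ...     | inj₁ cheap = inj₁ (e∈ , cheap)
      ...     | inj₂ rich = inj₂ λ _ → rich
    ...   | inj₁ (e , e∈ , P , c , D , c<) with ∈children⁻ S {p} e∈
    ...     | w~e , e≢p = inj₁ (_ , _ , step w~e e≢p D , lt _ c<)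
      where
      lt : ∀ b → c < suc k ℕ.∸ b → b ℕ.+ c < suc k
      lt b c< = subst (_≤ suc k) (ℕ.+-suc b c)
        (ℕ.≤-trans (ℕ.+-monoʳ-≤ b c<) (ℕ.≤-reflexive (ℕ.m+[n∸m]≡n {b}
          (ℕ.<⇒≤ (ℕ.m∸n≢0⇒n<m {suc k} {b} λ eq → ℕ.n≮0 (subst (c <_) eq c<))))))
    cheap-Down⊎Rich {p} {w} (acc rs) (suc k) | yes C≢∅ | inj₂ rich =
      inj₂ (node (λ p∈ → proj₂ (∈children⁻ S {p} {w} p∈) refl)
        (fan _ C≢∅ (λ e∈ → proj₂ S⊑T (proj₁ (∈children⁻ S {p} e∈)) , rich _ e∈)
          (le ∣ children S p w ∣ (Nonempty⇒1≤∣p∣ C≢∅))))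
      where
      le : ∀ m → 1 ≤ m → suc (suc k) ≤ m ℕ.+ (suc k ℕ.∸ ℕ.pred m)
      le (suc b) _ = s≤s (ℕ.m≤n+m∸n (suc k) b)

    -- A path cheaper than `c` contradicts minimality. Otherwise there is a fan of value `c`, or `c`
    -- is 0; on the empty board every fan is clear.
    weight≤ : ∀ {v x k} → v ∈ S.V → IsMinWeight S v x → Wins 1 T k ⊥ → x + + 2 ℤ.≤ + k
    weight≤ {v} {k = k} v∈ ((P , maximal , refl) , least) W with Maximal⇒Down v∈ maximal
    ... | c , D = subst (ℤ._≤ + k) (sym (Down⇒weight+2 D)) (ℤ.+≤+ c≤k)
      where
      c≤k : c ≤ k
      c≤k with cheap-Down⊎Rich (≺-acc (v , v)) c
      ... | inj₂ leaf = z≤n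
      ... | inj₂ (node _ G) = Wins⇒Bounds W G λ _ _ → ∉⊥
      ... | inj₁ (P′ , c′ , D′ , c′<c) = ⊥-elim (ℕ.<⇒≱ c′<c (ℤ.drop‿+≤+ (subst₂ ℤ._≤_
        (Down⇒weight+2 D) (Down⇒weight+2 D′)
        (ℤ.+-monoˡ-≤ (+ 2) (least _ (P′ , Down⇒Maximal v∈ D′ , refl))))))

  -- W is the vertex set of a subtree that witnesses Rich k p d. The bound on
  -- costs is stated for larger sets W′ that agree with W below d, so that it
  -- survives gluing W to other branches.
  Witness : ℕ → Fin n → Fin n → Subset n → Set
  Witness k p d W =
    d ∈ W ×
    (∀ {z} → z ∈ W → z ≡ d ⊎ ∃ λ e → d ~ e × e ≢ p × Branch d e z) ×
    (∀ {z} → z ∈ W → Star (Graph._~_ (T [ W ])) d z) ×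
    (∀ {W′} → W ⊆ W′ → (∀ {e z} → d ~ e → e ≢ p → Branch d e z → z ∈ W′ → z ∈ W) →
      ∀ {P c} → Down (T [ W′ ]) p d P c → k ≤ c)

  -- The pieces lie in different branches at `d`, so the glued set meets the branch of each child
  -- exactly in its piece, and the cost bounds of the pieces carry over.
  glue : ∀ {k p d C j} → p ∉ C → Nonempty C → suc k ≤ ∣ C ∣ ℕ.+ j →
         (Ws : Fin n → Subset n) → (∀ {e} → e ∈ C → d ~ e × Witness j d e (Ws e)) →
         ∃ (Witness k p d)
  glue {k} {p} {d} {C} {j} p∉C (e₀ , e₀∈C) le Ws wit = W , d∈W , below , reach , costs
    where
    W? : Decidable₁ (λ z → z ≡ d ⊎ ∃ λ e → e ∈ C × z ∈ Ws e)
    W? z = (z ≟ d) ⊎-dec any? (λ e → (e ∈? C) ×-dec (z ∈? Ws e))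
    W : Subset n
    W = ⟦ W? ⟧
    d∈W : d ∈ W
    d∈W = ∈⟦⟧⁺ W? (inj₁ refl)
    Ws⊆W : ∀ {e} → e ∈ C → Ws e ⊆ W
    Ws⊆W e∈C z∈ = ∈⟦⟧⁺ W? (inj₂ (_ , e∈C , z∈))
    Ws⇒Branch : ∀ {e z} → e ∈ C → z ∈ Ws e → Branch d e z
    Ws⇒Branch e∈C z∈ with wit e∈C
    ... | d~e , _ , below-e , _ with below-e z∈
    ...   | inj₁ refl = ε
    ...   | inj₂ (_ , e~e′ , e′≢d , e′z) = Branch-⊆ d~e e~e′ e′≢d e′z
    below : ∀ {z} → z ∈ W → z ≡ d ⊎ ∃ λ e → d ~ e × e ≢ p × Branch d e z
    below z∈ with ∈⟦⟧⁻ W? z∈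
    ... | inj₁ z≡d = inj₁ z≡d
    ... | inj₂ (e , e∈C , z∈e) =
      inj₂ (e , proj₁ (wit e∈C) , (λ { refl → p∉C e∈C }) , Ws⇒Branch e∈C z∈e)
    reach : ∀ {z} → z ∈ W → Star (Graph._~_ (T [ W ])) d z
    reach z∈ with ∈⟦⟧⁻ W? z∈
    ... | inj₁ refl = ε
    ... | inj₂ (e , e∈C , z∈e) with wit e∈C
    ...   | d~e , e∈e , _ , reach-e , _ = (d∈W , Ws⊆W e∈C e∈e , d~e) ◅
      Star-map (λ (a , b , a~b) → Ws⊆W e∈C a , Ws⊆W e∈C b , a~b) (reach-e z∈e)
    in-Ws : ∀ {e z} → d ~ e → Branch d e z → z ∈ W → e ∈ C × z ∈ Ws e
    in-Ws d~e ez z∈ with ∈⟦⟧⁻ W? z∈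
    ... | inj₁ refl = ⊥-elim (Branch⇒≢ d~e ez refl)
    ... | inj₂ (e′ , e′∈C , z∈e′)
      with Branch-unique d~e (proj₁ (wit e′∈C)) ez (Ws⇒Branch e′∈C z∈e′)
    ...   | refl = e′∈C , z∈e′
    costs : ∀ {W′} → W ⊆ W′ → (∀ {e z} → d ~ e → e ≢ p → Branch d e z → z ∈ W′ → z ∈ W) →
            ∀ {P c} → Down (T [ W′ ]) p d P c → k ≤ c
    costs {W′} W⊆W′ agree = bound
      where
      C⊆children : C ⊆ children (T [ W′ ]) p d
      C⊆children e∈C with wit e∈C
      ... | d~e , e∈e , _ = ∈children⁺ (T [ W′ ])
        (W⊆W′ d∈W , W⊆W′ (Ws⊆W e∈C e∈e) , d~e) λ { refl → p∉C e∈C }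
      pred-bound : ∀ m {c} → suc k ≤ m ℕ.+ c → k ≤ ℕ.pred m ℕ.+ c
      pred-bound zero le = ℕ.<⇒≤ le
      pred-bound (suc m) (s≤s le) = le
      bound : ∀ {P c} → Down (T [ W′ ]) p d P c → k ≤ c
      -- The path cannot end at `d`, since `e₀` is a neighbor other than `p`.
      bound (stop only-p) = ⊥-elim (p∉C (subst (_∈ C)
        (only-p (proj₁ (∈children⁻ (T [ W′ ]) {p} (C⊆children e₀∈C)))) e₀∈C))
      bound (step {e = e} {c = c} (_ , e∈W′ , d~e) e≢p D)
        with in-Ws d~e ε (agree d~e e≢p ε e∈W′)
      ... | e∈C , _ with wit e∈C
      ...   | _ , _ , _ , _ , costs-e = pred-bound ∣ children (T [ W′ ]) p d ∣
        (ℕ.≤-trans le (ℕ.+-mono-≤ (p⊆q⇒∣p∣≤∣q∣ C⊆children) (costs-e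
          (W⊆W′ ∘ Ws⊆W e∈C)
          (λ e~e′ e′≢d e′z z∈W′ → let ez = Branch-⊆ d~e e~e′ e′≢d e′z in
            proj₂ (in-Ws d~e ez (agree d~e e≢p ez z∈W′)))
          D)))

  Rich⇒Witness : ∀ {k p d} → Rich k p d → ∃ (Witness k p d)
  Rich⇒Witness {p = p} {d} leaf = ⁅ d ⁆ , x∈⁅x⁆ d , inj₁ ∘ x∈⁅y⁆⇒x≡y d ,
    (λ z∈ → subst (Star _ d) (sym (x∈⁅y⁆⇒x≡y d z∈)) ε) , λ _ _ _ → z≤n
  Rich⇒Witness {d = d} (node {C = C} p∉C (fan j C≢∅ f le)) =
    glue p∉C C≢∅ le (proj₁ ∘ choose) λ {e} e∈C → proj₁ (f e∈C) , proj₂ (choose e) e∈C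
    where
    choose : ∀ e → ∃ λ W → e ∈ C → Witness j d e W
    choose e with e ∈? C
    -- A default value: `glue` takes only the pieces of members of `C`.
    ... | no e∉C = ⊥ , λ e∈C → ⊥-elim (e∉C e∈C)
    ... | yes e∈C with f e∈C
    ...   | _ , r with Rich⇒Witness r
    ...     | W , wit = W , λ _ → wit

  -- The value of the whole tree

  fill-everything : ∀ m {F} → ∣ ∁ F ∣ ≤ m → Wins 1 T m F
  fill-everything m {F} ∣∁F∣≤ with unfilled-vertex F
  ... | inj₂ V⊆F = done V⊆F
  fill-everything zero ∣∁F∣≤ | inj₁ (z , _ , z∉F) =
    ⊥-elim (ℕ.<⇒≱ (Nonempty⇒1≤∣p∣ (z , x∉p⇒x∈∁p z∉F)) ∣∁F∣≤)
  fill-everything (suc m) ∣∁F∣≤ | inj₁ (z , z∈V , z∉F) = token z z∈V z∉F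
    (fill-everything m (ℕ.≤-pred (ℕ.≤-trans (∣∁[p∪⁅x⁆]∣<∣∁p∣ z∉F) ∣∁F∣≤)))

  -- The offset by one makes the value positive, so that the `leaf` case of `Rich` is excluded.
  HasFan : ℕ → Set
  HasFan k = ∃₂ λ v C → Fan (suc k) v C

  Fan⇒Rich : ∀ {k v C} → Fan k v C → Rich k v v
  Fan⇒Rich G = node (λ v∈C → ~-irrefl (Fan⇒~ G v∈C)) G

  HasFan? : Decidable₁ HasFan
  HasFan? k = map′ (λ { (v , node _ G) → v , _ , G }) (λ (v , _ , G) → v , Fan⇒Rich G)
                   (any? λ v → Rich? (suc k) v v)

  Wins⇒HasFan-bound : ∀ {k m} → Wins 1 T k ⊥ → HasFan m → m < k
  Wins⇒HasFan-bound W (_ , _ , G) = Wins⇒Bounds W G λ _ _ → ∉⊥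

  -- The climb ends because placing a token on every vertex wins with at most `N` tokens, which
  -- bounds all fans.
  largest-fan : HasFan 0 → ∃ λ k → HasFan k × ¬ HasFan (suc k)
  largest-fan = climb N (ℕ.m≤m+n N 0)
    where
    N : ℕ
    N = ∣ ∁ {n} ⊥ ∣
    climb : ∀ fuel {k} → N ≤ fuel ℕ.+ k → HasFan k → ∃ λ k → HasFan k × ¬ HasFan (suc k)
    climb fuel {k} N≤ has with HasFan? (suc k)
    ... | no none = k , has , none
    climb zero N≤ has | yes _ =
      ⊥-elim (ℕ.<⇒≱ (Wins⇒HasFan-bound (fill-everything N ℕ.≤-refl) has) N≤)
    climb (suc fuel) {k} N≤ _ | yes more =
      climb fuel (ℕ.≤-trans N≤ (ℕ.≤-reflexive (sym (ℕ.+-suc fuel k)))) more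

  -- One end of the edge has a second neighbor: `d` if `t` lies in its branch, and `v` otherwise.
  third-vertex⇒HasFan : ∀ {v d t} → v ~ d → t ∈ V → t ≢ v → t ≢ d → HasFan 0
  third-vertex⇒HasFan {v} {d} v~d t∈V t≢v t≢d with branch-of (~⇒∈V v~d) t∈V t≢v
  ... | e , v~e , et with e ≟ d
  ...   | no e≢d = v , _ , Fan-pair v~d v~e e≢d
  ...   | yes refl with Branch-descend v~d et t≢d
  ...     | e′ , d~e′ , e′≢v , _ = d , _ , Fan-pair (~-sym v~d) d~e′ e′≢v

  some-fan : 3 ≤ ∣ V ∣ → HasFan 0
  some-fan 3≤∣V∣ with proj₁ (proj₁ T-tree)
  ... | v , v∈V with ℕ.≤-pred (ℕ.≤-trans 3≤∣V∣ (∣p∣≤1+∣p-x∣ V v))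
  ...   | 2≤ with 1≤∣p∣⇒Nonempty (ℕ.<⇒≤ 2≤)
  ...     | z , z∈ with branch-of v∈V (p─q⊆p V ⁅ v ⁆ z∈) (x∈p-y⇒x≢y {p = V} z∈)
  ...       | d , v~d , _
    with 1≤∣p∣⇒Nonempty (ℕ.≤-pred (ℕ.≤-trans 2≤ (∣p∣≤1+∣p-x∣ (V - v) d)))
  ...         | t , t∈ = third-vertex⇒HasFan v~d (p─q⊆p V ⁅ v ⁆ t∈V-v)
                           (x∈p-y⇒x≢y {p = V} t∈V-v) (x∈p-y⇒x≢y {p = V - v} t∈)
    where
    t∈V-v : t ∈ V - v
    t∈V-v = p─q⊆p (V - v) ⁅ d ⁆ t∈

  -- On the empty board the first token lowers the cap from `suc k` to `k` and supplies the filled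
  -- vertex that `capped⇒Wins` requires.
  HasFan⇒Wins : ∀ {k} → HasFan k → ¬ HasFan (suc k) → Wins 1 T (suc k) ⊥
  HasFan⇒Wins (v , _ , fan _ (d , d∈C) f _) none =
    let x , x∈V , x∉⊥ , capped =
          best-token (λ G _ → none (_ , _ , G)) (λ _ → inj₁ λ _ → ∉⊥) (proj₁ (f d∈C)) ∉⊥
    in token x x∈V x∉⊥ (capped⇒Wins _ ℕ.≤-refl x∈V (x∈p∪⁅x⁆ {p = ⊥}) capped)

  -- In the subtree on the witness every path costs at least `suc k`. As no larger fan exists, some
  -- path costs less than `suc (suc k)`, so the minimum is attained at exactly `suc k`.
  HasFan⇒subtree : ∀ {k} → HasFan k → ¬ HasFan (suc k) →
    ∃₂ λ v S → S ⊑ T × Connected S × v ∈ Graph.V S ×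
               ∃ λ x → IsMinWeight S v x × x + + 2 ≡ + suc k
  HasFan⇒subtree {k} (v , C , G@(fan _ (d , d∈C) f _)) none
    with Rich⇒Witness (Fan⇒Rich G)
  ... | W , v∈W , _ , reach , costs = conclude (cheap-Down⊎Rich (≺-acc (v , v)) (suc (suc k)))
    where
    S : Graph n
    S = T [ W ]
    S⊑T : S ⊑ T
    S⊑T = p∩q⊆p V W , proj₂ ∘ proj₂
    open Subtree S S⊑T
    v∈S : v ∈ V ∩ W
    v∈S = x∈p∩q⁺ (~⇒∈V (proj₁ (f d∈C)) , v∈W)
    costs-S : ∀ {P c} → Down S v v P c → suc k ≤ c
    costs-S = costs id λ _ _ _ z∈W → z∈W
    conclude : (∃₂ λ P c → Down S v v P c × c < suc (suc k)) ⊎ Rich (suc (suc k)) v v → _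
    conclude (inj₂ (node _ G′)) = ⊥-elim (none (v , _ , G′))
    conclude (inj₁ (P , c , D , c<)) =
      v , S , S⊑T , connected-from S v∈S (λ z z∈ → reach (p∩q⊆q V W z∈)) , v∈S ,
      weight S P , ((P , Down⇒Maximal v∈S D , refl) , least) , weight≡
      where
      weight≡ : weight S P + + 2 ≡ + suc k
      weight≡ = trans (Down⇒weight+2 D) (cong +_ (ℕ.≤-antisym (ℕ.≤-pred c<) (costs-S D)))
      least : ∀ x → (∃ λ Q → MaximalPathFrom S v Q × x ≡ weight S Q) → weight S P ℤ.≤ x
      least _ (Q , maximal , refl) with Maximal⇒Down v∈S maximal
      ... | c′ , D′ = +2-cancel-≤ (subst₂ ℤ._≤_ (sym weight≡) (sym (Down⇒weight+2 D′))
                                         (ℤ.+≤+ (costs-S D′)))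

theorem4p1 : ∀ {n : ℕ} (T : Graph n) → IsTree T → 3 ≤ ∣ Graph.V T ∣ →
    ∃₂ λ (z : ℕ) (m : ℤ) → IsZ 1 T z × IsMaxMaxMinWeight T m × + z ≡ + 2 + m
theorem4p1 T T-tree 3≤∣V∣ =
  let k , has , none = largest-fan (some-fan 3≤∣V∣)
      wins = HasFan⇒Wins has none
      v , S , S⊑T , conn , v∈S , m , min , m+2≡ = HasFan⇒subtree has none
      greatest : ∀ v x → (∃ λ S → S ⊑ T × Connected S × v ∈ Graph.V S × IsMinWeight S v x) →
                 x ℤ.≤ m
      greatest v x (S , S⊑T , _ , v∈S , min) = +2-cancel-≤
        (subst (x + + 2 ℤ.≤_) (sym m+2≡) (Subtree.weight≤ S S⊑T v∈S min wins))
  in suc k , m ,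
     (wins , λ k′ wins′ → Wins⇒HasFan-bound wins′ has) ,
     ((v , proj₁ S⊑T v∈S , (S , S⊑T , conn , v∈S , min) , greatest v) ,
      λ { x (v′ , _ , attained , _) → greatest v′ x attained }) ,
     trans (sym m+2≡) (ℤ.+-comm m (+ 2))
  where open Tree T T-tree
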